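{- Let $M_G$ be a mixed graph with vertex set $V$ and edge set $E$, and let $V_1\subseteq V$ be nonempty. Then \[\det(L[V_1])=\sum_{M_R}3^{\gamma_1}4^{\gamma_2},\] where the sum runs over all substructures $M_R$ with vertex set $V_1$ (i.e. over all edge subsets $E_1\subseteq E$ with $|E_1|=|V_1|$) that are substructures of type I, and $\gamma_1$, $\gamma_2$ are the numbers of components of $M_R$ that are unicyclic graphs belonging to $\Phi_2$ and to $\Phi_3$, respectively. Here $L[V_1]$ is the principal submatrix of $L(M_G)$ with rows and columns indexed by $V_1$.
   Context: All graphs are simple, finite and connected. A mixed graph $M_G$ is obtained from a graph $G$ (its underlying graph) by giving directions to some edges. Let $\omega=\frac{1+\sqrt{3}\mathbf{i}}{2}$. $N(M_G)=(n_{ij})$ has $n_{ij}=1$ if $v_i,v_j$ are joined by an undirected edge, $n_{ij}=\omega$ if there is an edge directed $v_i\to v_j$, $n_{ij}=\overline{\omega}$ if directed $v_j\to v_i$, and $0$ otherwise; $L(M_G)=D(M_G)-N(M_G)$ where $D(M_G)$ is the degree diagonal matrix of $G$. A substructure $M_R$ with vertex subset $V_1\subseteq V$ and edge subset $E_1\subseteq E$ consists of these vertices and edges (an edge of $E_1$ may have one or no endpoint in $V_1$); it is square if $|V_1|=|E_1|$. Its components are the connected pieces of the structure with vertices $V_1$ and edges $E_1$, where each edge of $E_1$ joins those of its endpoints lying in $V_1$ (an edge with no endpoint in $V_1$ is a component on its own). A component is a rootless tree if it is obtained from a tree by deleting one vertex (the root) while keeping the incident edge as an edge with only one endpoint; equivalently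 its edges with both endpoints in $V_1$ form a tree on its vertices and it contains exactly one edge of $E_1$ with exactly one endpoint in $V_1$. A component is a unicyclic graph if all its edges have both endpoints in $V_1$ and it is a connected graph with exactly one cycle. For a mixed cycle, fix a cyclic traversal direction; let $a$ (resp. $b$) be the number of directed edges oriented along (resp. against) the traversal. The cycle belongs to $\Phi_1$ if $a-b\equiv 1$ or $5\pmod 6$, to $\Phi_2$ if $a-b\equiv 2$ or $4\pmod 6$, to $\Phi_3$ if $a-b\equiv 3\pmod 6$, and to $\Phi_4$ if $a-b\equiv 0\pmod 6$; a unicyclic mixed graph belongs to the class of its cycle. A square substructure is of type I if each of its components is either a rootless tree or a unicyclic graph not belonging to $\Phi_4$. -}

module Defs where

open import Data.Nat as ℕ using (ℕ; zero; suc)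
open import Data.Integer as ℤ using (ℤ; +_; -[1+_])
open import Data.Fin as Fin using (Fin; zero; suc; toℕ; punchIn)
open import Data.List as List using (List; []; _∷_; _++_; length; allFin; map; concatMap)
open import Data.Nat.ListAction using (sum)
open import Data.Nat.DivMod using (_mod_)
open import Data.Product using (Σ; Σ-syntax; ∃; ∃-syntax; _×_; _,_; proj₁; proj₂)
open import Data.Sum using (_⊎_; inj₁; inj₂)
open import Data.Empty using (⊥)
open import Data.Bool using (Bool; true; false; if_then_else_; _∧_)
open import Relation.Binary.PropositionalEquality using (_≡_; _≢_)
open import Relation.Binary.Construct.Closure.ReflexiveTransitive using (Star)
open import Relation.Nullary using (¬_)

-- Eisenstein integers ℤ[ω], ω = (1 + √3 i)/2, so ω² = ω - 1 and
-- ω̄ = 1 - ω.  An element  re + im·ω  is stored as the pair (re , im).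
-- All entries of N(M_G), L(M_G) (and hence all minors) lie in ℤ[ω] ⊂ ℂ.

record ℤω : Set where
  constructor _+_ω
  field
    re : ℤ
    im : ℤ

infixl 6 _+ω_ _-ω_
infixl 7 _*ω_

_+ω_ : ℤω → ℤω → ℤω
(a + b ω) +ω (c + d ω) = (a ℤ.+ c) + (b ℤ.+ d) ω

-ω_ : ℤω → ℤω
-ω (a + b ω) = (ℤ.- a) + (ℤ.- b) ω

_-ω_ : ℤω → ℤω → ℤω
x -ω y = x +ω (-ω y)

-- (a + bω)(c + dω) = ac + (ad + bc)ω + bd ω²  and  ω² = ω - 1
_*ω_ : ℤω → ℤω → ℤω
(a + b ω) *ω (c + d ω) = (a ℤ.* c ℤ.- b ℤ.* d) + (a ℤ.* d ℤ.+ b ℤ.* c ℤ.+ b ℤ.* d) ω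

0ω 1ω ω ω̄ : ℤω
0ω = (+ 0) + (+ 0) ω
1ω = (+ 1) + (+ 0) ω
ω  = (+ 0) + (+ 1) ω
ω̄  = (+ 1) + (-[1+ 0 ]) ω

fromℕω : ℕ → ℤω
fromℕω k = (+ k) + (+ 0) ω

sumFin : ∀ k → (Fin k → ℤω) → ℤω
sumFin zero    f = 0ω
sumFin (suc k) f = f zero +ω sumFin k (λ i → f (suc i))

signω : ℕ → ℤω
signω zero          = 1ω
signω (suc zero)    = -ω 1ω
signω (suc (suc j)) = signω j

det : ∀ k → (Fin k → Fin k → ℤω) → ℤω
det zero    M = 1ω
det (suc k) M =
  sumFin (suc k) λ j →
    signω (toℕ j) *ω M zero j *ω det k (λ a b → M (suc a) (punchIn j b))

-- Mixed graphs on vertex set Fin n.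
-- kind i j = none  : no edge between v_i and v_j
--          = undir : undirected edge
--          = out   : edge directed v_i → v_j
--          = inc   : edge directed v_j → v_i

data EdgeKind : Set where
  none undir out inc : EdgeKind

rev : EdgeKind → EdgeKind
rev none  = none
rev undir = undir
rev out   = inc
rev inc   = out

isEdge : EdgeKind → Bool
isEdge none = false
isEdge _    = true

Adjacent : ∀ {n} → (Fin n → Fin n → EdgeKind) → Fin n → Fin n → Set
Adjacent κ i j = κ i j ≢ none

record MixedGraph (n : ℕ) : Set where
  field
    kind      : Fin n → Fin n → EdgeKind
    loopless  : ∀ i → kind i i ≡ none
    symmetric : ∀ i j → kind j i ≡ rev (kind i j)
    connected : ∀ i j → Star (Adjacent kind) i j

open MixedGraph public

nEntry : EdgeKind → ℤω
nEntry none  = 0ω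
nEntry undir = 1ω
nEntry out   = ω
nEntry inc   = ω̄

degree : ∀ {n} → MixedGraph n → Fin n → ℕ
degree {n} G i = sum (map (λ j → if isEdge (kind G i j) then 1 else 0) (allFin n))

diagEntry : ∀ {n} → MixedGraph n → Fin n → Fin n → ℤω
diagEntry G i j with i Fin.≟ j
... | Relation.Nullary.yes _ = fromℕω (degree G i)
... | Relation.Nullary.no  _ = 0ω

Lap : ∀ {n} → MixedGraph n → Fin n → Fin n → ℤω
Lap G i j = diagEntry G i j -ω nEntry (kind G i j)

-- principal submatrix L[V₁], V₁ listed by an (injective) ι
principal : ∀ {n k} → MixedGraph n → (Fin k → Fin n) → Fin k → Fin k → ℤω
principal G ι a b = Lap G (ι a) (ι b)

Edge : ℕ → Set
Edge n = Fin n × Fin n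

edges : ∀ {n} → MixedGraph n → List (Edge n)
edges {n} G =
  concatMap (λ i → concatMap (λ j →
      if isEdge (kind G i j) ∧ (toℕ i ℕ.<ᵇ toℕ j) then (i , j) ∷ [] else [])
    (allFin n)) (allFin n)

-- all sub-lists (= all subsets of a duplicate-free list)
sublists : ∀ {A : Set} → List A → List (List A)
sublists []       = [] ∷ []
sublists (x ∷ xs) = map (x ∷_) (sublists xs) ++ sublists xs

-- Substructures M_R with vertex set V₁ = image of ι : Fin k → Fin n and
-- edge set E₁ (a list of edges; its i-th edge is  List.lookup E₁ i).

module Substructure {n k : ℕ} (G : MixedGraph n) (ι : Fin k → Fin n)
                    (E₁ : List (Edge n)) where

  m : ℕ
  m = length E₁

  edge : Fin m → Edge n
  edge = List.lookup E₁

  InV₁ : Fin n → Set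
  InV₁ u = ∃[ a ] ι a ≡ u

  Incident : Fin k → Fin m → Set
  Incident a e = (ι a ≡ proj₁ (edge e)) ⊎ (ι a ≡ proj₂ (edge e))

  Full : Fin m → Set
  Full e = InV₁ (proj₁ (edge e)) × InV₁ (proj₂ (edge e))

  Half : Fin m → Set
  Half e = (InV₁ (proj₁ (edge e)) × ¬ InV₁ (proj₂ (edge e)))
         ⊎ (¬ InV₁ (proj₁ (edge e)) × InV₁ (proj₂ (edge e)))

  -- the elements (vertices of V₁ and edges of E₁) of the structure, and
  -- the incidence relation which determines its components
  Node : Set
  Node = Fin k ⊎ Fin m

  Link : Node → Node → Set
  Link (inj₁ a) (inj₂ e) = Incident a e
  Link (inj₂ e) (inj₁ a) = Incident a e
  Link _        _        = ⊥

  record Components (c : ℕ) : Set where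
    field
      label    : Node → Fin c
      surj     : ∀ j → ∃[ x ] label x ≡ j
      sound    : ∀ x y → label x ≡ label y → Star Link x y
      complete : ∀ x y → Star Link x y → label x ≡ label y

  module Component {c : ℕ} (C : Components c) (j : Fin c) where
    open Components C

    VIn : Fin k → Set
    VIn a = label (inj₁ a) ≡ j

    EIn : Fin m → Set
    EIn e = label (inj₂ e) ≡ j

    FullAdj : Fin k → Fin k → Set
    FullAdj a b = ∃[ e ] EIn e ×
      (((proj₁ (edge e) ≡ ι a) × (proj₂ (edge e) ≡ ι b))
       ⊎ ((proj₁ (edge e) ≡ ι b) × (proj₂ (edge e) ≡ ι a)))

    FullConnected : Set
    FullConnected = ∀ a b → VIn a → VIn b → Star FullAdj a b

    next : ∀ {l} → Fin (suc l) → Fin (suc l)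
    next {l} i = (suc (toℕ i)) mod (suc l)

    record Cycle : Set where
      field
        l      : ℕ               -- the cycle has length  suc l
        long   : 2 ℕ.≤ l
        vert   : Fin (suc l) → Fin k
        inj    : ∀ x y → vert x ≡ vert y → x ≡ y
        inComp : ∀ x → VIn (vert x)
        adj    : ∀ x → FullAdj (vert x) (vert (next x))

    OnCycle : Cycle → Fin k → Fin k → Set
    OnCycle Z a b = ∃[ x ] ((vert x ≡ a × vert (next x) ≡ b)
                           ⊎ (vert x ≡ b × vert (next x) ≡ a))
      where open Cycle Z

    -- a - b for the traversal  vert 0 → vert 1 → … → vert 0
    stepTwist : EdgeKind → ℤ
    stepTwist out = + 1
    stepTwist inc = -[1+ 0 ]
    stepTwist _   = + 0

    twist : Cycle → ℤ
    twist Z = sumℤ (suc l) (λ x → stepTwist (kind G (ι (vert x)) (ι (vert (next x)))))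
      where
        open Cycle Z
        sumℤ : ∀ r → (Fin r → ℤ) → ℤ
        sumℤ zero    f = + 0
        sumℤ (suc r) f = f zero ℤ.+ sumℤ r (λ i → f (suc i))

    residue : Cycle → ℕ
    residue Z = twist Z ℤ.%ℕ 6

    HasVertex : Set
    HasVertex = ∃[ a ] VIn a

    RootlessTree : Set
    RootlessTree =
      HasVertex × FullConnected × ¬ Cycle ×
      (∃[ e ] (EIn e × Half e × (∀ e' → EIn e' → Half e' → e' ≡ e)))

    -- unicyclic: all edges have both ends in V₁, connected, exactly one
    -- cycle (any two cycles have the same edge set), and that cycle
    -- satisfies the class condition P on a - b mod 6
    UnicyclicWith : (ℕ → Set) → Set
    UnicyclicWith P =
      (∀ e → EIn e → Full e) × HasVertex × FullConnected ×
      (Σ[ Z ∈ Cycle ] (P (residue Z) ×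
         (∀ Z' a b → (OnCycle Z a b → OnCycle Z' a b) × (OnCycle Z' a b → OnCycle Z a b))))

  Φ₁ Φ₂ Φ₃ : ℕ → Set
  Φ₁ r = (r ≡ 1) ⊎ (r ≡ 5)
  Φ₂ r = (r ≡ 2) ⊎ (r ≡ 4)
  Φ₃ r = r ≡ 3

  data CompKind : Set where
    rootlessTree uniΦ₁ uniΦ₂ uniΦ₃ : CompKind

  HasKind : ∀ {c} → Components c → Fin c → CompKind → Set
  HasKind C j rootlessTree = Component.RootlessTree C j
  HasKind C j uniΦ₁        = Component.UnicyclicWith C j Φ₁
  HasKind C j uniΦ₂        = Component.UnicyclicWith C j Φ₂
  HasKind C j uniΦ₃        = Component.UnicyclicWith C j Φ₃

  count : ∀ {c} → (CompKind → Bool) → (Fin c → CompKind) → ℕ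
  count {c} p κ = sum (map (λ j → if p (κ j) then 1 else 0) (allFin c))

  isΦ₂ isΦ₃ : CompKind → Bool
  isΦ₂ uniΦ₂ = true
  isΦ₂ _     = false
  isΦ₃ uniΦ₃ = true
  isΦ₃ _     = false

  -- M_R is of type I (every component a rootless tree or a unicyclic graph
  -- not in Φ₄), with γ₁ components unicyclic in Φ₂ and γ₂ in Φ₃
  TypeIWith : ℕ → ℕ → Set
  TypeIWith γ₁ γ₂ =
    Σ[ c ∈ ℕ ] Σ[ C ∈ Components c ] Σ[ κ ∈ (Fin c → CompKind) ]
      ((∀ j → HasKind C j (κ j)) × count isΦ₂ κ ≡ γ₁ × count isΦ₃ κ ≡ γ₂)

{-# OPTIONS --safe #-}

-- L = S S* for the vertex-edge incidence matrix S, so Cauchy–Binet writes det L[V₁] as the sum of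
-- |det S[V₁,E₁]|² over the edge sets E₁ with |E₁| = |V₁|.  If every component of E₁ contains a half edge
-- or a cycle, the rows of S[V₁,E₁] can be ordered, starting from these and then following edges outwards, so
-- that the matrix becomes block triangular; a half edge or a tree edge gives a unit, and a cycle whose
-- monodromy is ω^t gives |1 - ω^t|², which is 0, 1, 3, 4, 3, 1 for t = 0, …, 5.  Conversely, if the
-- determinant is nonzero, one of its terms is a perfect matching between vertices and incident edges; orienting
-- every edge away from its matched vertex turns E₁ into a functional graph, each component of which has
-- exactly one root (a half edge) or exactly one cycle.
module Submission where

open import Defs
open import Algebra using (CommutativeRing)
open import Algebra.Structures using (IsCommutativeRing)
open import Data.Bool using (true; false; if_then_else_; _∧_; T)
open import Data.Empty using (⊥)
open import Data.Fin as Fin using (Fin; zero; suc; toℕ; punchIn; splitAt)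
import Data.Fin.Properties as Finₚ
open import Data.Integer as ℤ using (ℤ; +_; -[1+_])
import Data.Integer.DivMod as ℤDM
import Data.Integer.Properties as ℤₚ
open import Data.Integer.Tactic.RingSolver using () renaming (solve-∀ to ℤ-solve-∀)
open import Data.List as List using (List; []; _∷_; _++_; length; map; tabulate; allFin; concatMap; filter)
import Data.List.Membership.DecPropositional as DecMembership
open import Data.List.Membership.Propositional using (_∈_; _∉_; find)
import Data.List.Membership.Propositional.Properties as ∈ₚ
open import Data.List.Membership.Propositional.Properties.WithK using (unique∧set⇒bag)
import Data.List.Properties as Listₚ
open import Data.List.Relation.Binary.BagAndSetEquality using (∼bag⇒↭)
open import Data.List.Relation.Binary.Permutation.Propositional using (_↭_; refl; prep; swap; trans; ↭-sym)
import Data.List.Relation.Binary.Permutation.Propositional.Properties as ↭ₚ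
open import Data.List.Relation.Unary.All as All using (All; []; _∷_)
import Data.List.Relation.Unary.All.Properties as Allₚ
open import Data.List.Relation.Unary.AllPairs using ([]; _∷_)
open import Data.List.Relation.Unary.Any using (here; there)
open import Data.List.Relation.Unary.Unique.Propositional using (Unique)
import Data.List.Relation.Unary.Unique.Propositional.Properties as Uniqueₚ
open import Data.Maybe using (just; nothing)
open import Data.Nat as ℕ using (ℕ; zero; suc)
open import Data.Nat.Divisibility using (_∣_; 0∣⇒≡0)
import Data.Nat.DivMod as DM
open import Data.Nat.DivMod using (_mod_; _%_)
open import Data.Nat.ListAction using (sum; product)
open import Data.Nat.ListAction.Properties using (∈⇒∣product)
import Data.Nat.Properties as ℕₚ
open import Data.Nat.Tactic.RingSolver using () renaming (solve-∀ to ℕ-solve-∀)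
open import Data.Product using (∃-syntax; _×_; _,_; proj₁; proj₂)
open import Data.Sum as Sum using (_⊎_; inj₁; inj₂)
open import Function using (_∘_; id)
open import Function.Bundles using (mk⇔)
open import Function.Definitions using (Injective)
open import Level using (0ℓ)
open import Relation.Binary using (tri<; tri≈; tri>)
open import Relation.Binary.Construct.Closure.ReflexiveTransitive as Star using (Star; ε; _◅_; _◅◅_)
open import Relation.Binary.PropositionalEquality as ≡ using (_≡_; _≢_; cong; cong₂; subst; subst₂; isEquivalence; module ≡-Reasoning)
open import Relation.Nullary using (yes; no; Dec; ¬_; contradiction; does)
open import Relation.Nullary.Decidable using (map′; _×-dec_; _⊎-dec_; ¬?; ¬¬-excluded-middle; decidable-stable)
open import Tactic.RingSolver using (solve-∀)
open import Tactic.RingSolver.Core.AlmostCommutativeRing using (AlmostCommutativeRing; fromCommutativeRing)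

-- Being of type I is never decided. The weight `w` is any function with the prescribed values on
-- edge sets of type I and on the others, and the partition of an edge set into components is
-- obtained only under a double negation. This is harmless: the claim for a single edge set is an
-- equation in ℤ[ω], which is decidable and hence stable. Determinants are recast over lists of rows
-- and lists of columns, so that choosing edges, reordering and splitting off blocks become
-- operations on lists. Lists of different lengths get determinant 0, and Cauchy-Binet can then sum
-- over all sublists. After it, determinants enter only through their norms, so signs and unit
-- pivots need no bookkeeping. The product formula over components asks, besides |E₁| = |V₁|, only
-- for connectedness and one half edge or cycle in each component. It therefore serves both
-- directions: it evaluates substructures of type I, and it shows that a nonzero determinant
-- excludes cycles in Φ₄, which would contribute a factor 0.

private variable
  A C X Y : Set

-- The ring ℤ[ω]

+ω-*ω-isCommutativeRing : IsCommutativeRing _≡_ _+ω_ _*ω_ (λ x → -ω x) 0ω 1ω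
+ω-*ω-isCommutativeRing = record
  { isRing = record
    { +-isAbelianGroup = record
      { isGroup = record
        { isMonoid = record
          { isSemigroup = record
            { isMagma = record { isEquivalence = isEquivalence ; ∙-cong = cong₂ _+ω_ }
            ; assoc = λ (a + a' ω) (b + b' ω) (c + c' ω) → cong₂ _+_ω (ℤₚ.+-assoc a b c) (ℤₚ.+-assoc a' b' c')
            }
          ; identity = (λ (a + a' ω) → cong₂ _+_ω (ℤₚ.+-identityˡ a) (ℤₚ.+-identityˡ a'))
                     , (λ (a + a' ω) → cong₂ _+_ω (ℤₚ.+-identityʳ a) (ℤₚ.+-identityʳ a'))
          }
        ; inverse = (λ (a + a' ω) → cong₂ _+_ω (ℤₚ.+-inverseˡ a) (ℤₚ.+-inverseˡ a'))
                  , (λ (a + a' ω) → cong₂ _+_ω (ℤₚ.+-inverseʳ a) (ℤₚ.+-inverseʳ a'))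
        ; ⁻¹-cong = cong (λ x → -ω x)
        }
      ; comm = λ (a + a' ω) (b + b' ω) → cong₂ _+_ω (ℤₚ.+-comm a b) (ℤₚ.+-comm a' b')
      }
    ; *-cong = cong₂ _*ω_
    ; *-assoc = λ (a + a' ω) (b + b' ω) (c + c' ω) → cong₂ _+_ω (assoc-re a a' b b' c c') (assoc-im a a' b b' c c')
    ; *-identity = (λ (a + a' ω) → cong₂ _+_ω (idˡ-re a a') (idˡ-im a a'))
                 , (λ (a + a' ω) → cong₂ _+_ω (idʳ-re a a') (idʳ-im a a'))
    ; distrib = (λ (a + a' ω) (b + b' ω) (c + c' ω) → cong₂ _+_ω (distˡ-re a a' b b' c c') (distˡ-im a a' b b' c c'))
              , (λ (a + a' ω) (b + b' ω) (c + c' ω) → cong₂ _+_ω (distʳ-re a a' b b' c c') (distʳ-im a a' b b' c c'))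
    }
  ; *-comm = λ (a + a' ω) (b + b' ω) → cong₂ _+_ω (comm-re a a' b b') (comm-im a a' b b')
  }
  where
  open import Data.Integer using (_+_; _*_; _-_)
  assoc-re : ∀ a a' b b' c c' → (a * b - a' * b') * c - (a * b' + a' * b + a' * b') * c' ≡ a * (b * c - b' * c') - a' * (b * c' + b' * c + b' * c')
  assoc-re = ℤ-solve-∀
  assoc-im : ∀ a a' b b' c c' → (a * b - a' * b') * c' + (a * b' + a' * b + a' * b') * c + (a * b' + a' * b + a' * b') * c'
           ≡ a * (b * c' + b' * c + b' * c') + a' * (b * c - b' * c') + a' * (b * c' + b' * c + b' * c')
  assoc-im = ℤ-solve-∀
  idˡ-re : ∀ a a' → + 1 * a - + 0 * a' ≡ a
  idˡ-re = ℤ-solve-∀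
  idˡ-im : ∀ a a' → + 1 * a' + + 0 * a + + 0 * a' ≡ a'
  idˡ-im = ℤ-solve-∀
  idʳ-re : ∀ a a' → a * + 1 - a' * + 0 ≡ a
  idʳ-re = ℤ-solve-∀
  idʳ-im : ∀ a a' → a * + 0 + a' * + 1 + a' * + 0 ≡ a'
  idʳ-im = ℤ-solve-∀
  distˡ-re : ∀ a a' b b' c c' → a * (b + c) - a' * (b' + c') ≡ a * b - a' * b' + (a * c - a' * c')
  distˡ-re = ℤ-solve-∀
  distˡ-im : ∀ a a' b b' c c' → a * (b' + c') + a' * (b + c) + a' * (b' + c') ≡ a * b' + a' * b + a' * b' + (a * c' + a' * c + a' * c')
  distˡ-im = ℤ-solve-∀
  distʳ-re : ∀ a a' b b' c c' → (b + c) * a - (b' + c') * a' ≡ b * a - b' * a' + (c * a - c' * a')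
  distʳ-re = ℤ-solve-∀
  distʳ-im : ∀ a a' b b' c c' → (b + c) * a' + (b' + c') * a + (b' + c') * a' ≡ b * a' + b' * a + b' * a' + (c * a' + c' * a + c' * a')
  distʳ-im = ℤ-solve-∀
  comm-re : ∀ a a' b b' → a * b - a' * b' ≡ b * a - b' * a'
  comm-re = ℤ-solve-∀
  comm-im : ∀ a a' b b' → a * b' + a' * b + a' * b' ≡ b * a' + b' * a + b' * a'
  comm-im = ℤ-solve-∀

ℤω-ring : CommutativeRing 0ℓ 0ℓ
ℤω-ring = record { isCommutativeRing = +ω-*ω-isCommutativeRing }

ℤω-acr : AlmostCommutativeRing 0ℓ 0ℓ
ℤω-acr = fromCommutativeRing ℤω-ring λ where
  ((+ 0) + (+ 0) ω) → just ≡.refl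
  _ → nothing

_≟ω_ : (x y : ℤω) → Dec (x ≡ y)
(a + b ω) ≟ω (c + d ω) = map′ (λ { (≡.refl , ≡.refl) → ≡.refl }) (λ { ≡.refl → ≡.refl , ≡.refl }) ((a ℤ.≟ c) ×-dec (b ℤ.≟ d))

-- Since ω̄ = 1 - ω, the conjugate of a + bω is (a + b) - bω.
conj : ℤω → ℤω
conj (a + b ω) = (a ℤ.+ b) + (ℤ.- b) ω

conj-+ : ∀ x y → conj (x +ω y) ≡ conj x +ω conj y
conj-+ (a + b ω) (c + d ω) = cong₂ _+_ω (re-eq a b c d) (ℤₚ.neg-distrib-+ b d)
  where
  re-eq : ∀ a b c d → a ℤ.+ c ℤ.+ (b ℤ.+ d) ≡ a ℤ.+ b ℤ.+ (c ℤ.+ d)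
  re-eq = ℤ-solve-∀

conj-neg : ∀ x → conj (-ω x) ≡ -ω conj x
conj-neg (a + b ω) = cong₂ _+_ω (≡.sym (ℤₚ.neg-distrib-+ a b)) ≡.refl

conj-* : ∀ x y → conj (x *ω y) ≡ conj x *ω conj y
conj-* (a + b ω) (c + d ω) = cong₂ _+_ω (re-eq a b c d) (im-eq a b c d)
  where
  open import Data.Integer using (_+_; _*_; _-_; -_)
  re-eq : ∀ a b c d → a * c - b * d + (a * d + b * c + b * d) ≡ (a + b) * (c + d) - (- b) * (- d)
  re-eq = ℤ-solve-∀
  im-eq : ∀ a b c d → - (a * d + b * c + b * d) ≡ (a + b) * (- d) + (- b) * (c + d) + (- b) * (- d)
  im-eq = ℤ-solve-∀

normω : ℤω → ℤω
normω x = x *ω conj x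

normω-* : ∀ x y → normω (x *ω y) ≡ normω x *ω normω y
normω-* x y = ≡.trans (cong (x *ω y *ω_) (conj-* x y)) (interchange x y (conj x) (conj y))
  where
  interchange : ∀ a b c d → a *ω b *ω (c *ω d) ≡ a *ω c *ω (b *ω d)
  interchange = solve-∀ ℤω-acr

Unit : ℤω → Set
Unit x = normω x ≡ 1ω

unit-* : ∀ x y → Unit x → Unit y → Unit (x *ω y)
unit-* x y p q = ≡.trans (normω-* x y) (cong₂ _*ω_ p q)

*ω-identityˡ : ∀ x → 1ω *ω x ≡ x
*ω-identityˡ = solve-∀ ℤω-acr

*ω-assoc : ∀ x y z → x *ω y *ω z ≡ x *ω (y *ω z)
*ω-assoc = solve-∀ ℤω-acr

-- This is how signs and unit pivots disappear: they have norm 1.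
unit-absorb : ∀ x z {y} → Unit x → y ≡ x *ω z → normω y ≡ normω z
unit-absorb x z p q = ≡.trans (cong normω q) (≡.trans (normω-* x z) (≡.trans (cong (_*ω normω z) p) (*ω-identityˡ _)))

-- Laplace expansion

-- Laplace expansion along the row `r`, where `h` evaluates the complementary minor on the remaining
-- columns. The alternating signs come from subtracting the whole expansion of the tail, in which
-- the skipped column `c` is put back in front. An arbitrary `h` allows expansions along several
-- rows to be nested and exchanged.
expand : (C → ℤω) → (List C → ℤω) → List C → ℤω
expand r h []       = 0ω
expand r h (c ∷ cs) = r c *ω h cs -ω expand r (λ ds → h (c ∷ ds)) cs

-- Defined for lists of any lengths, with value 0 when they differ, so that Cauchy-Binet can range
-- over all sublists.
Det : List (C → ℤω) → List C → ℤω
Det []       []      = 1ω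
Det []       (_ ∷ _) = 0ω
Det (r ∷ rs) cs      = expand r (Det rs) cs

expand-cong : {r s : C → ℤω} {h g : List C → ℤω} → (∀ c → r c ≡ s c) → (∀ cs → h cs ≡ g cs) →
              ∀ cs → expand r h cs ≡ expand s g cs
expand-cong p q []       = ≡.refl
expand-cong p q (c ∷ cs) = cong₂ _-ω_ (cong₂ _*ω_ (p c) (q cs)) (expand-cong p (λ ds → q (c ∷ ds)) cs)

expand-congʰ : (r : C → ℤω) {h g : List C → ℤω} → (∀ cs → h cs ≡ g cs) → ∀ cs → expand r h cs ≡ expand r g cs
expand-congʰ r = expand-cong (λ _ → ≡.refl)

expand-+ : (r : C → ℤω) (h g : List C → ℤω) → ∀ cs → expand r (λ ds → h ds +ω g ds) cs ≡ expand r h cs +ω expand r g cs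
expand-+ r h g []       = ≡.refl
expand-+ r h g (c ∷ cs) = ≡.trans (cong (λ w → r c *ω (h cs +ω g cs) -ω w) (expand-+ r _ _ cs)) (eq (r c) (h cs) (g cs) _ _)
  where
  eq : ∀ r h g x y → r *ω (h +ω g) -ω (x +ω y) ≡ r *ω h -ω x +ω (r *ω g -ω y)
  eq = solve-∀ ℤω-acr

expand-* : (r : C → ℤω) (x : ℤω) (h : List C → ℤω) → ∀ cs → expand r (λ ds → x *ω h ds) cs ≡ x *ω expand r h cs
expand-* r x h []       = eq x
  where
  eq : ∀ x → 0ω ≡ x *ω 0ω
  eq = solve-∀ ℤω-acr
expand-* r x h (c ∷ cs) = ≡.trans (cong (λ w → r c *ω (x *ω h cs) -ω w) (expand-* r x _ cs)) (eq (r c) x (h cs) _)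
  where
  eq : ∀ r x h y → r *ω (x *ω h) -ω x *ω y ≡ x *ω (r *ω h -ω y)
  eq = solve-∀ ℤω-acr

expand-linearʳ : (r s : C → ℤω) (x : ℤω) (h : List C → ℤω) → ∀ cs →
                 expand (λ c → r c +ω x *ω s c) h cs ≡ expand r h cs +ω x *ω expand s h cs
expand-linearʳ r s x h []       = eq x
  where
  eq : ∀ x → 0ω ≡ 0ω +ω x *ω 0ω
  eq = solve-∀ ℤω-acr
expand-linearʳ r s x h (c ∷ cs) =
  ≡.trans (cong (λ w → (r c +ω x *ω s c) *ω h cs -ω w) (expand-linearʳ r s x _ cs)) (eq (r c) (s c) x (h cs) _ _)
  where
  eq : ∀ r s x h y z → (r +ω x *ω s) *ω h -ω (y +ω x *ω z) ≡ r *ω h -ω y +ω x *ω (s *ω h -ω z)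
  eq = solve-∀ ℤω-acr

expand-zeroʰ : (r : C → ℤω) {h : List C → ℤω} → (∀ cs → h cs ≡ 0ω) → ∀ cs → expand r h cs ≡ 0ω
expand-zeroʰ r p []       = ≡.refl
expand-zeroʰ r p (c ∷ cs) = ≡.trans (cong₂ (λ a b → r c *ω a -ω b) (p cs) (expand-zeroʰ r (λ ds → p (c ∷ ds)) cs)) (eq (r c))
  where
  eq : ∀ x → x *ω 0ω -ω 0ω ≡ 0ω
  eq = solve-∀ ℤω-acr

expand-zeroʳ : {r : C → ℤω} (h : List C → ℤω) → (∀ c → r c ≡ 0ω) → ∀ cs → expand r h cs ≡ 0ω
expand-zeroʳ h p []       = ≡.refl
expand-zeroʳ h p (c ∷ cs) = ≡.trans (cong₂ (λ a b → a *ω h cs -ω b) (p c) (expand-zeroʳ _ p cs)) (eq (h cs))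
  where
  eq : ∀ x → 0ω *ω x -ω 0ω ≡ 0ω
  eq = solve-∀ ℤω-acr

expand-neg : (r : C → ℤω) (h : List C → ℤω) → ∀ cs → expand r (λ ds → -ω h ds) cs ≡ -ω expand r h cs
expand-neg r h cs = ≡.trans (expand-congʰ r (λ ds → eq (h ds)) cs) (≡.trans (expand-* r (-ω 1ω) h cs) (≡.sym (eq _)))
  where
  eq : ∀ x → -ω x ≡ (-ω 1ω) *ω x
  eq = solve-∀ ℤω-acr

-- Splits a double expansion by which row takes the first column: `r`, `s` or neither. Exchanging
-- `r` and `s` interchanges the first two terms, which carry opposite signs; this is the induction
-- step of `expand-anticomm` and `expand-square`.
expand-expand : (r s : C → ℤω) (h : List C → ℤω) → ∀ c cs →
  expand r (expand s h) (c ∷ cs) ≡ r c *ω expand s h cs -ω (s c *ω expand r h cs -ω expand r (expand s (λ ds → h (c ∷ ds))) cs)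
expand-expand r s h c cs = cong (λ w → r c *ω expand s h cs -ω w)
  (≡.trans (expand-+ r _ _ cs) (cong₂ _+ω_ (expand-* r (s c) h cs) (expand-neg r _ cs)))

expand-anticomm : (r s : C → ℤω) (h : List C → ℤω) → ∀ cs → expand r (expand s h) cs ≡ -ω expand s (expand r h) cs
expand-anticomm r s h []       = ≡.refl
expand-anticomm r s h (c ∷ cs) = ≡.trans (expand-expand r s h c cs)
  (≡.trans (cong (λ a → r c *ω expand s h cs -ω (s c *ω expand r h cs -ω a)) (expand-anticomm r s _ cs))
  (≡.trans (eq (r c) (expand s h cs) (s c) (expand r h cs) (expand s (expand r (λ ds → h (c ∷ ds))) cs)) (cong (λ x → -ω x) (≡.sym (expand-expand s r h c cs)))))
  where
  eq : ∀ a b c d e → a *ω b -ω (c *ω d -ω (-ω e)) ≡ -ω (c *ω d -ω (a *ω b -ω e))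
  eq = solve-∀ ℤω-acr

expand-square : (r : C → ℤω) (h : List C → ℤω) → ∀ cs → expand r (expand r h) cs ≡ 0ω
expand-square r h []       = ≡.refl
expand-square r h (c ∷ cs) = ≡.trans (expand-expand r r h c cs)
  (≡.trans (cong (λ a → r c *ω expand r h cs -ω (r c *ω expand r h cs -ω a)) (expand-square r _ cs)) (eq (r c *ω expand r h cs)))
  where
  eq : ∀ a → a -ω (a -ω 0ω) ≡ 0ω
  eq = solve-∀ ℤω-acr

-- No sign appears, because `u` and `v` delete entries from two different lists.
expand-comm : (u : A → ℤω) (v : C → ℤω) (h : List A → List C → ℤω) → ∀ as cs →
              expand u (λ bs → expand v (h bs) cs) as ≡ expand v (λ ds → expand u (λ bs → h bs ds) as) cs
expand-comm u v h []       cs = ≡.sym (expand-zeroʰ v (λ _ → ≡.refl) cs)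
expand-comm u v h (a ∷ as) cs = ≡.trans (cong (λ w → u a *ω expand v (h as) cs -ω w) (expand-comm u v (h ∘ (a ∷_)) as cs))
  (≡.sym (≡.trans (expand-+ v _ _ cs) (cong₂ _+ω_ (expand-* v (u a) (h as) cs) (expand-neg v _ cs))))

-- The prefix `ps` lets the property pass through `expand`, whose recursion puts columns in front of
-- the argument of `h`.
Alternating : (List C → ℤω) → Set
Alternating h = ∀ ps c d cs → h (ps ++ c ∷ d ∷ cs) ≡ -ω h (ps ++ d ∷ c ∷ cs)

expand-alternating : (r : C → ℤω) {h : List C → ℤω} → Alternating h → Alternating (expand r h)
expand-alternating r {h} alt [] c d cs =
  ≡.trans (cong (λ a → r c *ω h (d ∷ cs) -ω (r d *ω h (c ∷ cs) -ω a))
            (≡.trans (expand-congʰ r (alt [] c d) cs) (expand-neg r _ cs)))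
          (eq (r c) (h (d ∷ cs)) (r d) (h (c ∷ cs)) _)
  where
  eq : ∀ a b c d e → a *ω b -ω (c *ω d -ω (-ω e)) ≡ -ω (c *ω d -ω (a *ω b -ω e))
  eq = solve-∀ ℤω-acr
expand-alternating r {h} alt (p ∷ ps) c d cs =
  ≡.trans (cong₂ (λ a b → r p *ω a -ω b) (alt ps c d cs) (expand-alternating r (λ qs → alt (p ∷ qs)) ps c d cs)) (eq (r p) _ _)
  where
  eq : ∀ a b c → a *ω (-ω b) -ω (-ω c) ≡ -ω (a *ω b -ω c)
  eq = solve-∀ ℤω-acr

Det-alternating : (rs : List (C → ℤω)) → Alternating (Det rs)
Det-alternating []       []      c d cs = ≡.refl
Det-alternating []       (_ ∷ _) c d cs = ≡.refl
Det-alternating (r ∷ rs) = expand-alternating r (Det-alternating rs)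

neg≡-1* : ∀ x → -ω x ≡ (-ω 1ω) *ω x
neg≡-1* = solve-∀ ℤω-acr

-- Each `swap` contributes a factor -1. The resulting sign is not computed; only its norm is
-- recorded.
alternating-↭ : (h : List C → ℤω) → Alternating h → ∀ {cs ds} → cs ↭ ds → ∃[ s ] Unit s × h cs ≡ s *ω h ds
alternating-↭ h alt refl = 1ω , ≡.refl , ≡.sym (*ω-identityˡ _)
alternating-↭ h alt (prep x p) = alternating-↭ (λ es → h (x ∷ es)) (λ ps → alt (x ∷ ps)) p
alternating-↭ h alt {_ ∷ _ ∷ cs} {_ ∷ _ ∷ ds} (swap x y p) with alternating-↭ (λ es → h (y ∷ x ∷ es)) (λ ps → alt (y ∷ x ∷ ps)) p
... | s , us , eq = (-ω 1ω) *ω s , unit-* (-ω 1ω) s ≡.refl us ,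
  ≡.trans (alt [] x y _) (≡.trans (neg≡-1* (h (y ∷ x ∷ cs))) (≡.trans (cong ((-ω 1ω) *ω_) eq) (≡.sym (*ω-assoc (-ω 1ω) s (h (y ∷ x ∷ ds))))))
alternating-↭ h alt (trans p q) with alternating-↭ h alt p | alternating-↭ h alt q
... | s , us , eq | t , ut , eq' = s *ω t , unit-* s t us ut , ≡.trans eq (≡.trans (cong (s *ω_) eq') (≡.sym (*ω-assoc s t _)))

Det-rows-↭ : {rs ss : List (C → ℤω)} → rs ↭ ss → ∃[ s ] Unit s × ∀ cs → Det rs cs ≡ s *ω Det ss cs
Det-rows-↭ refl = 1ω , ≡.refl , λ cs → ≡.sym (*ω-identityˡ _)
Det-rows-↭ (prep r p) with Det-rows-↭ p
... | s , us , eq = s , us , λ cs → ≡.trans (expand-congʰ r eq cs) (expand-* r s _ cs)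
Det-rows-↭ {ss = _ ∷ _ ∷ ss} (swap r t p) with Det-rows-↭ p
... | s , us , eq = (-ω 1ω) *ω s , unit-* (-ω 1ω) s ≡.refl us , λ cs →
  ≡.trans (expand-anticomm r t _ cs) (≡.trans (cong (λ x → -ω x)
    (≡.trans (expand-congʰ t (λ ds → ≡.trans (expand-congʰ r eq ds) (expand-* r s _ ds)) cs) (expand-* t s _ cs)))
    (≡.trans (neg≡-1* (s *ω Det (t ∷ r ∷ ss) cs)) (≡.sym (*ω-assoc (-ω 1ω) s (Det (t ∷ r ∷ ss) cs)))))
Det-rows-↭ (trans p q) with Det-rows-↭ p | Det-rows-↭ q
... | s , us , eq | t , ut , eq' = s *ω t , unit-* s t us ut , λ cs →
  ≡.trans (eq cs) (≡.trans (cong (s *ω_) (eq' cs)) (≡.sym (*ω-assoc s t _)))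

normω-Det-↭ : {rs ss : List (C → ℤω)} {cs ds : List C} → rs ↭ ss → cs ↭ ds → normω (Det rs cs) ≡ normω (Det ss ds)
normω-Det-↭ {rs = rs} {ss} {cs} {ds} p q with Det-rows-↭ p | alternating-↭ (Det ss) (Det-alternating ss) q
... | s , us , eq | t , ut , eq' = ≡.trans (unit-absorb s (Det ss cs) us (eq cs)) (unit-absorb t (Det ss ds) ut eq')

Det-length : (rs : List (C → ℤω)) (cs : List C) → length rs ≢ length cs → Det rs cs ≡ 0ω
Det-length []       []       p = contradiction ≡.refl p
Det-length []       (_ ∷ _)  p = ≡.refl
Det-length (r ∷ rs) []       p = ≡.refl
Det-length (r ∷ rs) (c ∷ cs) p = ≡.trans (cong₂ (λ a b → r c *ω a -ω b)
  (Det-length rs cs (p ∘ cong suc)) (rest (λ ds → Det rs (c ∷ ds)) cs λ ds q → Det-length rs (c ∷ ds) λ e → p (cong suc (≡.trans e q)))) (eq (r c))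
  where
  eq : ∀ x → x *ω 0ω -ω 0ω ≡ 0ω
  eq = solve-∀ ℤω-acr
  -- Generalised over `h`, which has to vanish only on lists one shorter than `cs`; the function
  -- `h (c ∷ _)` of the recursion inherits this.
  rest : ∀ h cs → (∀ ds → suc (length ds) ≡ length cs → h ds ≡ 0ω) → expand r h cs ≡ 0ω
  rest h []       z = ≡.refl
  rest h (c ∷ cs) z = ≡.trans (cong₂ (λ a b → r c *ω a -ω b) (z cs ≡.refl) (rest _ cs λ ds q → z (c ∷ ds) (cong suc q))) (eq (r c))

-- Agreement of the list determinant with `det`

sumFin-cong : ∀ k {f g : Fin k → ℤω} → (∀ i → f i ≡ g i) → sumFin k f ≡ sumFin k g
sumFin-cong zero    p = ≡.refl
sumFin-cong (suc k) p = cong₂ _+ω_ (p zero) (sumFin-cong k (p ∘ suc))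

sumFin-neg : ∀ k (f : Fin k → ℤω) → sumFin k (λ i → -ω f i) ≡ -ω sumFin k f
sumFin-neg zero    f = ≡.refl
sumFin-neg (suc k) f = ≡.trans (cong ((-ω f zero) +ω_) (sumFin-neg k (f ∘ suc))) (eq (f zero) (sumFin k (f ∘ suc)))
  where
  eq : ∀ x y → (-ω x) +ω (-ω y) ≡ -ω (x +ω y)
  eq = solve-∀ ℤω-acr

signω-suc : ∀ j → signω (suc j) ≡ -ω signω j
signω-suc zero          = ≡.refl
signω-suc (suc zero)    = ≡.refl
signω-suc (suc (suc j)) = signω-suc j

-- `punchIn (suc j)` keeps column 0 in front, so the summands after the first form the expansion of
-- the tail with `c zero` put back; the shift of `signω` by one supplies the minus sign.
expand-tabulate : ∀ k (r : C → ℤω) (h : List C → ℤω) (c : Fin (suc k) → C) →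
  sumFin (suc k) (λ j → signω (toℕ j) *ω r (c j) *ω h (tabulate (c ∘ punchIn j))) ≡ expand r h (tabulate c)
expand-tabulate zero    r h c = eq (r (c zero)) (h [])
  where
  eq : ∀ x y → 1ω *ω x *ω y +ω 0ω ≡ x *ω y -ω 0ω
  eq = solve-∀ ℤω-acr
expand-tabulate (suc k) r h c = ≡.trans (cong (1ω *ω r (c zero) *ω h (tabulate (c ∘ suc)) +ω_) tail)
  (eq (r (c zero)) (h (tabulate (c ∘ suc))) (expand r (λ ds → h (c zero ∷ ds)) (tabulate (c ∘ suc))))
  where
  eq : ∀ x y z → 1ω *ω x *ω y +ω (-ω z) ≡ x *ω y -ω z
  eq = solve-∀ ℤω-acr
  eq' : ∀ s x y → (-ω s) *ω x *ω y ≡ -ω (s *ω x *ω y)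
  eq' = solve-∀ ℤω-acr
  tail : sumFin (suc k) (λ j → signω (toℕ (suc j)) *ω r (c (suc j)) *ω h (tabulate (c ∘ punchIn (suc j))))
       ≡ -ω expand r (λ ds → h (c zero ∷ ds)) (tabulate (c ∘ suc))
  tail = ≡.trans (sumFin-cong (suc k) λ j →
           ≡.trans (cong (λ s → s *ω r (c (suc j)) *ω h (tabulate (c ∘ punchIn (suc j)))) (signω-suc (toℕ j)))
                   (eq' (signω (toℕ j)) (r (c (suc j))) (h (tabulate (c ∘ punchIn (suc j))))))
         (≡.trans (sumFin-neg (suc k) (λ j → signω (toℕ j) *ω r (c (suc j)) *ω h (c zero ∷ tabulate (c ∘ suc ∘ punchIn j))))
                  (cong (λ x → -ω x) (expand-tabulate k r (λ ds → h (c zero ∷ ds)) (c ∘ suc))))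

-- Columns are read through a map `c` because the minors of `det` select theirs by `c ∘ punchIn j`.
det≡Det : ∀ k (M : Fin k → C → ℤω) (c : Fin k → C) → det k (λ a b → M a (c b)) ≡ Det (tabulate M) (tabulate c)
det≡Det zero    M c = ≡.refl
det≡Det (suc k) M c = ≡.trans
  (sumFin-cong (suc k) λ j → cong (signω (toℕ j) *ω M zero (c j) *ω_) (det≡Det k (M ∘ suc) (c ∘ punchIn j)))
  (expand-tabulate k (M zero) (Det (tabulate (M ∘ suc))) c)

Det-cong : (f g : X → C → ℤω) → (∀ x c → f x c ≡ g x c) → ∀ xs cs → Det (map f xs) cs ≡ Det (map g xs) cs
Det-cong f g p []       cs = ≡.refl
Det-cong f g p (x ∷ xs) cs = expand-cong (p x) (Det-cong f g p xs) cs

Det-conj : (f : X → C → ℤω) → ∀ xs cs → Det (map (λ x c → conj (f x c)) xs) cs ≡ conj (Det (map f xs) cs)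
Det-conj f []       []      = ≡.refl
Det-conj f []       (_ ∷ _) = ≡.refl
Det-conj f (x ∷ xs) cs      = ≡.trans (expand-congʰ (λ c → conj (f x c)) (Det-conj f xs) cs) (go (Det (map f xs)) cs)
  where
  go : ∀ h cs → expand (λ c → conj (f x c)) (λ ds → conj (h ds)) cs ≡ conj (expand (f x) h cs)
  go h []       = ≡.refl
  go h (c ∷ cs) = ≡.trans (cong₂ _-ω_ (≡.sym (conj-* (f x c) (h cs))) (go (λ ds → h (c ∷ ds)) cs))
    (≡.sym (≡.trans (conj-+ (f x c *ω h cs) (-ω expand (f x) (λ ds → h (c ∷ ds)) cs))
                    (cong (conj (f x c *ω h cs) +ω_) (conj-neg (expand (f x) (λ ds → h (c ∷ ds)) cs)))))

-- Cauchy–Binet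

sumω : List X → (X → ℤω) → ℤω
sumω []       f = 0ω
sumω (x ∷ xs) f = f x +ω sumω xs f

sumω-cong : (xs : List X) {f g : X → ℤω} → (∀ x → f x ≡ g x) → sumω xs f ≡ sumω xs g
sumω-cong []       p = ≡.refl
sumω-cong (x ∷ xs) p = cong₂ _+ω_ (p x) (sumω-cong xs p)

sumω-++ : (xs ys : List X) (f : X → ℤω) → sumω (xs ++ ys) f ≡ sumω xs f +ω sumω ys f
sumω-++ []       ys f = eq (sumω ys f)
  where
  eq : ∀ x → x ≡ 0ω +ω x
  eq = solve-∀ ℤω-acr
sumω-++ (x ∷ xs) ys f = ≡.trans (cong (f x +ω_) (sumω-++ xs ys f)) (eq (f x) (sumω xs f) (sumω ys f))
  where
  eq : ∀ x y z → x +ω (y +ω z) ≡ x +ω y +ω z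
  eq = solve-∀ ℤω-acr

sumω-map : (g : X → Y) (xs : List X) (f : Y → ℤω) → sumω (map g xs) f ≡ sumω xs (f ∘ g)
sumω-map g []       f = ≡.refl
sumω-map g (x ∷ xs) f = cong (f (g x) +ω_) (sumω-map g xs f)

expand-sumω : (r : C → ℤω) (xs : List X) (h : X → List C → ℤω) → ∀ cs →
              expand r (λ ds → sumω xs (λ x → h x ds)) cs ≡ sumω xs (λ x → expand r (h x) cs)
expand-sumω r []       h cs = expand-zeroʰ r (λ _ → ≡.refl) cs
expand-sumω r (x ∷ xs) h cs = ≡.trans (expand-+ r (h x) (λ ds → sumω xs (λ y → h y ds)) cs)
  (cong (expand r (h x) cs +ω_) (expand-sumω r xs h cs))

-- A rank one matrix changes the determinant only to first order, since a term using it in two rows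
-- would contain the row `v` twice. The correction sums u_a v_c times the signed minors of `y`,
-- written as a double expansion that deletes a row index and a column.
Det-rankOne-update : (u : A → ℤω) (v : C → ℤω) (y : A → C → ℤω) → ∀ as cs →
  Det (map (λ a c → u a *ω v c +ω y a c) as) cs ≡ Det (map y as) cs +ω expand u (λ bs → expand v (Det (map y bs)) cs) as
Det-rankOne-update u v y []       cs = eq (Det [] cs)
  where
  eq : ∀ x → x ≡ x +ω 0ω
  eq = solve-∀ ℤω-acr
Det-rankOne-update u v y (a ∷ as) cs = begin
  expand (λ c → u a *ω v c +ω y a c) (Det (map (λ b c → u b *ω v c +ω y b c) as)) cs
    ≡⟨ expand-cong (λ c → +-swap (u a *ω v c) (y a c)) (Det-rankOne-update u v y as) cs ⟩
  expand (λ c → y a c +ω u a *ω v c) D cs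
    ≡⟨ expand-linearʳ (y a) v (u a) D cs ⟩
  expand (y a) D cs +ω u a *ω expand v D cs
    ≡⟨ cong₂ (λ p q → p +ω u a *ω q) (expand-+ (y a) D₀ D₁ cs) (expand-+ v D₀ D₁ cs) ⟩
  expand (y a) D₀ cs +ω expand (y a) D₁ cs +ω u a *ω (expand v D₀ cs +ω expand v D₁ cs)
    ≡⟨ cong₂ (λ p q → expand (y a) D₀ cs +ω p +ω u a *ω (expand v D₀ cs +ω q)) crossed vanish ⟩
  expand (y a) D₀ cs +ω (-ω F) +ω u a *ω (expand v D₀ cs +ω 0ω)
    ≡⟨ eq (expand (y a) D₀ cs) F (u a) (expand v D₀ cs) ⟩
  expand (y a) D₀ cs +ω (u a *ω expand v D₀ cs -ω F) ∎
  where
  open ≡-Reasoning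
  D₀ D₁ D : List _ → ℤω
  D₀ ds = Det (map y as) ds
  D₁ ds = expand u (λ bs → expand v (Det (map y bs)) ds) as
  D ds  = D₀ ds +ω D₁ ds
  F : ℤω
  F = expand u (λ bs → expand v (Det (y a ∷ map y bs)) cs) as
  +-swap : ∀ p q → p +ω q ≡ q +ω p
  +-swap = solve-∀ ℤω-acr
  eq : ∀ p f x q → p +ω (-ω f) +ω x *ω (q +ω 0ω) ≡ p +ω (x *ω q -ω f)
  eq = solve-∀ ℤω-acr
  vanish : expand v D₁ cs ≡ 0ω
  vanish = ≡.trans (≡.sym (expand-comm u v (λ bs → expand v (Det (map y bs))) as cs))
                   (expand-zeroʰ u (λ bs → expand-square v (Det (map y bs)) cs) as)
  -- The row `y a` has to be moved past the row `v`, which gives the sign.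
  crossed : expand (y a) D₁ cs ≡ -ω F
  crossed = ≡.trans (≡.sym (expand-comm u (y a) (λ bs → expand v (Det (map y bs))) as cs))
    (≡.trans (expand-congʰ u (λ bs → expand-anticomm (y a) v (Det (map y bs)) cs) as)
             (expand-neg u (λ bs → expand v (Det (y a ∷ map y bs)) cs) as))

-- Induction on `es`: the head `e` contributes a rank one matrix, so the determinant splits into a
-- sum over the sublists avoiding `e` and a correction, which is the sum over those containing it.
cauchyBinet : (u : X → A → ℤω) (v : X → C → ℤω) → ∀ es as cs →
  Det (map (λ a c → sumω es (λ e → u e a *ω v e c)) as) cs
  ≡ sumω (sublists es) (λ F → Det (map u F) as *ω Det (map v F) cs)
cauchyBinet u v [] []       cs = eq (Det [] cs)
  where
  eq : ∀ x → x ≡ 1ω *ω x +ω 0ω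
  eq = solve-∀ ℤω-acr
cauchyBinet u v [] (a ∷ as) cs = ≡.trans (expand-zeroʳ _ (λ _ → ≡.refl) cs) (eq (Det [] cs))
  where
  eq : ∀ x → 0ω ≡ 0ω *ω x +ω 0ω
  eq = solve-∀ ℤω-acr
cauchyBinet u v (e ∷ es) as cs = begin
  Det (map (λ a c → u e a *ω v e c +ω y a c) as) cs
    ≡⟨ Det-rankOne-update (u e) (v e) y as cs ⟩
  Det (map y as) cs +ω expand (u e) (λ bs → expand (v e) (Det (map y bs)) cs) as
    ≡⟨ cong₂ _+ω_ (cauchyBinet u v es as cs) with-e ⟩
  sumω (sublists es) term +ω sumω (sublists es) (term ∘ (e ∷_))
    ≡⟨ +-swap (sumω (sublists es) term) (sumω (sublists es) (term ∘ (e ∷_))) ⟩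
  sumω (sublists es) (term ∘ (e ∷_)) +ω sumω (sublists es) term
    ≡⟨ cong (_+ω sumω (sublists es) term) (sumω-map (e ∷_) (sublists es) term) ⟨
  sumω (map (e ∷_) (sublists es)) term +ω sumω (sublists es) term
    ≡⟨ sumω-++ (map (e ∷_) (sublists es)) (sublists es) term ⟨
  sumω (sublists (e ∷ es)) term ∎
  where
  open ≡-Reasoning
  y : _ → _ → ℤω
  y a c = sumω es (λ e → u e a *ω v e c)
  term : List _ → ℤω
  term F = Det (map u F) as *ω Det (map v F) cs
  +-swap : ∀ p q → p +ω q ≡ q +ω p
  +-swap = solve-∀ ℤω-acr
  *-swap : ∀ p q → p *ω q ≡ q *ω p
  *-swap = solve-∀ ℤω-acr
  -- Once the induction hypothesis is applied to every minor, the two expansions act on different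
  -- factors, and each becomes the expansion along the row of `e` in one of the two determinants.
  with-e : expand (u e) (λ bs → expand (v e) (Det (map y bs)) cs) as ≡ sumω (sublists es) (term ∘ (e ∷_))
  with-e = begin
    expand (u e) (λ bs → expand (v e) (Det (map y bs)) cs) as
      ≡⟨ expand-congʰ (u e) (λ bs → ≡.trans (expand-congʰ (v e) (cauchyBinet u v es bs) cs)
           (≡.trans (expand-sumω (v e) (sublists es) (λ F ds → Det (map u F) bs *ω Det (map v F) ds) cs)
                    (sumω-cong (sublists es) λ F → ≡.trans (expand-* (v e) (Det (map u F) bs) (Det (map v F)) cs)
                                                           (*-swap (Det (map u F) bs) (Det (map v (e ∷ F)) cs))))) as ⟩
    expand (u e) (λ bs → sumω (sublists es) (λ F → Det (map v (e ∷ F)) cs *ω Det (map u F) bs)) as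
      ≡⟨ expand-sumω (u e) (sublists es) (λ F bs → Det (map v (e ∷ F)) cs *ω Det (map u F) bs) as ⟩
    sumω (sublists es) (λ F → expand (u e) (λ bs → Det (map v (e ∷ F)) cs *ω Det (map u F) bs) as)
      ≡⟨ sumω-cong (sublists es) (λ F → ≡.trans (expand-* (u e) (Det (map v (e ∷ F)) cs) (Det (map u F)) as)
                                                (*-swap (Det (map v (e ∷ F)) cs) (Det (map u (e ∷ F)) as))) ⟩
    sumω (sublists es) (term ∘ (e ∷_)) ∎

-- Sparse determinants

Det-zeroColumn : (rs : List (C → ℤω)) (c : C) (cs : List C) → All (λ r → r c ≡ 0ω) rs → Det rs (c ∷ cs) ≡ 0ω
Det-zeroColumn []       c cs []       = ≡.refl
Det-zeroColumn (r ∷ rs) c cs (p ∷ ps) = ≡.trans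
  (cong₂ (λ a b → a *ω Det rs cs -ω b) p (expand-zeroʰ r (λ ds → Det-zeroColumn rs c ds ps) cs)) (eq (Det rs cs))
  where
  eq : ∀ x → 0ω *ω x -ω 0ω ≡ 0ω
  eq = solve-∀ ℤω-acr

Det-pivot : (r : C → ℤω) (rs : List (C → ℤω)) (c : C) (cs : List C) → All (λ r → r c ≡ 0ω) rs →
            Det (r ∷ rs) (c ∷ cs) ≡ r c *ω Det rs cs
Det-pivot r rs c cs ps = ≡.trans (cong (λ w → r c *ω Det rs cs -ω w) (expand-zeroʰ r (λ ds → Det-zeroColumn rs c ds ps) cs))
  (eq (r c *ω Det rs cs))
  where
  eq : ∀ x → x -ω 0ω ≡ x
  eq = solve-∀ ℤω-acr

Det-repeatedRow : (r : C → ℤω) (ms rs : List (C → ℤω)) → ∀ cs → Det (r ∷ ms ++ r ∷ rs) cs ≡ 0ω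
Det-repeatedRow r []       rs cs = expand-square r (Det rs) cs
Det-repeatedRow r (m ∷ ms) rs cs = ≡.trans (expand-anticomm r m (Det (ms ++ r ∷ rs)) cs)
  (cong (λ x → -ω x) (expand-zeroʰ m (Det-repeatedRow r ms rs) cs))

Det-rowLinear : (ms : List (C → ℤω)) (q q' s : C → ℤω) (x : ℤω) (rs : List (C → ℤω)) →
  (∀ c → q c ≡ q' c +ω x *ω s c) → ∀ cs → Det (ms ++ q ∷ rs) cs ≡ Det (ms ++ q' ∷ rs) cs +ω x *ω Det (ms ++ s ∷ rs) cs
Det-rowLinear []       q q' s x rs p cs = ≡.trans (expand-cong p (λ _ → ≡.refl) cs) (expand-linearʳ q' s x (Det rs) cs)
Det-rowLinear (m ∷ ms) q q' s x rs p cs = ≡.trans (expand-congʰ m (Det-rowLinear ms q q' s x rs p) cs)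
  (≡.trans (expand-+ m (Det (ms ++ q' ∷ rs)) (λ ds → x *ω Det (ms ++ s ∷ rs) ds) cs)
           (cong (Det (m ∷ ms ++ q' ∷ rs) cs +ω_) (expand-* m x (Det (ms ++ s ∷ rs)) cs)))

Det-rowOperation : (r : C → ℤω) (ms : List (C → ℤω)) (q q' : C → ℤω) (x : ℤω) (rs : List (C → ℤω)) →
  (∀ c → q c ≡ q' c +ω x *ω r c) → ∀ cs → Det (r ∷ ms ++ q ∷ rs) cs ≡ Det (r ∷ ms ++ q' ∷ rs) cs
Det-rowOperation r ms q q' x rs p cs = ≡.trans (Det-rowLinear (r ∷ ms) q q' r x rs p cs)
  (≡.trans (cong (λ w → Det (r ∷ ms ++ q' ∷ rs) cs +ω x *ω w) (Det-repeatedRow r ms rs cs)) (eq (Det (r ∷ ms ++ q' ∷ rs) cs) x))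
  where
  eq : ∀ d x → d +ω x *ω 0ω ≡ d
  eq = solve-∀ ℤω-acr

expand-nonzero : (r : C → ℤω) (h : List C → ℤω) → ∀ cs → expand r h cs ≢ 0ω →
  ∃[ c ] ∃[ ds ] (c ∷ ds ↭ cs) × r c ≢ 0ω × h ds ≢ 0ω
expand-nonzero r h []       nz = contradiction ≡.refl nz
expand-nonzero r h (c ∷ cs) nz with (r c *ω h cs) ≟ω 0ω
... | no p = c , cs , refl , (λ z → p (≡.trans (cong (_*ω h cs) z) (zeroˡ (h cs)))) , (λ z → p (≡.trans (cong (r c *ω_) z) (zeroʳ (r c))))
  where
  zeroˡ : ∀ x → 0ω *ω x ≡ 0ω
  zeroˡ = solve-∀ ℤω-acr
  zeroʳ : ∀ x → x *ω 0ω ≡ 0ω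
  zeroʳ = solve-∀ ℤω-acr
... | yes z with expand-nonzero r (λ ds → h (c ∷ ds)) cs (λ e → nz (cong₂ _-ω_ z e))
...   | d , ds , p , rd , hd = d , c ∷ ds , trans (swap d c refl) (prep c p) , rd , hd

-- A nonzero determinant has a nonzero term in its Leibniz expansion, and `τ` is the permutation of
-- that term. It can be found because vanishing in ℤ[ω] is decidable.
Det-nonzero⇒matching : ∀ m (ρ : Fin m → C → ℤω) (cs : List C) → Det (tabulate ρ) cs ≢ 0ω →
  ∃[ τ ] (tabulate τ ↭ cs) × (∀ e → ρ e (τ e) ≢ 0ω)
Det-nonzero⇒matching zero    ρ []       nz = (λ ()) , refl , λ ()
Det-nonzero⇒matching zero    ρ (c ∷ cs) nz = contradiction ≡.refl nz
Det-nonzero⇒matching (suc m) ρ cs       nz with expand-nonzero (ρ zero) (Det (tabulate (ρ ∘ suc))) cs nz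
... | c , ds , p , ρc , nz' with Det-nonzero⇒matching m (ρ ∘ suc) ds nz'
...   | τ , q , ρτ = (λ { zero → c ; (suc e) → τ e }) , trans (prep c q) p , λ { zero → ρc ; (suc e) → ρτ e }

δ : ∀ {n} → Fin n → Fin n → ℤω
δ a b = if does (a Fin.≟ b) then 1ω else 0ω

δ-refl : ∀ {n} (a : Fin n) → δ a a ≡ 1ω
δ-refl a with a Fin.≟ a
... | yes _ = ≡.refl
... | no ¬p = contradiction ≡.refl ¬p

δ-≢ : ∀ {n} {a b : Fin n} → a ≢ b → δ a b ≡ 0ω
δ-≢ {a = a} {b} p with a Fin.≟ b
... | yes q = contradiction q p
... | no _  = ≡.refl

segment : (ℕ → X) → ℕ → ℕ → List X
segment g t zero    = []
segment g t (suc s) = g t ∷ segment g (suc t) s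

productω : List ℤω → ℤω
productω []       = 1ω
productω (x ∷ xs) = x *ω productω xs

segment-All : {P : X → Set} (g : ℕ → X) (t s : ℕ) → (∀ i → t ℕ.≤ i → i ℕ.< t ℕ.+ s → P (g i)) → All P (segment g t s)
segment-All g t zero    p = []
segment-All g t (suc s) p = p t ℕₚ.≤-refl (ℕₚ.m<m+n t ℕ.z<s)
  ∷ segment-All g (suc t) s (λ i q r → p i (ℕₚ.<⇒≤ q) (ℕₚ.≤-trans r (ℕₚ.≤-reflexive (≡.sym (ℕₚ.+-suc t s)))))

-- Adding multiples of the rows t, …, l - 1 moves the second entry of the last
-- row q along the path v t, …, v l until it meets the first one.
module CycleDet {K : ℕ} (l : ℕ) (v : ℕ → Fin K) (u w : ℕ → ℤω) (R : ℕ → Fin K → ℤω)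
  (u-unit : ∀ t → Unit (u t))
  (R-shape : ∀ t c → R t c ≡ u t *ω (δ (v t) c -ω w t *ω δ (v (suc t)) c))
  (v-distinct : ∀ {t t'} → t ℕ.< t' → t' ℕ.≤ l → v t ≢ v t')
  (rs : List (Fin K → ℤω)) (cs : List (Fin K))
  (rs-zero : ∀ t → t ℕ.≤ l → All (λ r → r (v t) ≡ 0ω) rs) where

  -- The last row after its second entry has been moved to `v t`; `y` collects the weights passed on
  -- the way.
  lastRow : ℤω → ℤω → ℕ → Fin K → ℤω
  lastRow z y t c = z *ω (δ (v l) c -ω y *ω δ (v t) c)

  private
    δ-zero : ∀ {t t'} → t ℕ.< t' → t' ℕ.≤ l → δ (v t') (v t) ≡ 0ω
    δ-zero p q = δ-≢ (λ e → v-distinct p q (≡.sym e))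

  reduce : ∀ s t z y → t ℕ.+ s ≡ l →
    Det (segment R t s ++ lastRow z y t ∷ rs) (segment v t s ++ v l ∷ cs)
    ≡ productω (segment u t s) *ω (z *ω (1ω -ω y *ω productω (segment w t s)) *ω Det rs cs)
  reduce zero t z y p with ≡.trans (≡.sym (ℕₚ.+-identityʳ t)) p
  -- Here `t` is `l`: both entries of the last row lie in the same column, and the pivot is z (1 -
  -- y).
  ... | ≡.refl = ≡.trans (Det-pivot (lastRow z y t) rs (v t) cs (rs-zero t ℕₚ.≤-refl))
    (≡.trans (cong (λ d → z *ω (d -ω y *ω d) *ω Det rs cs) (δ-refl (v t))) (eq z y (Det rs cs)))
    where
    eq : ∀ z y d → z *ω (1ω -ω y *ω 1ω) *ω d ≡ 1ω *ω (z *ω (1ω -ω y *ω 1ω) *ω d)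
    eq = solve-∀ ℤω-acr
  reduce (suc s) t z y p = begin
    Det (R t ∷ ms ++ lastRow z y t ∷ rs) (v t ∷ ds)
      -- `conj (u t)` is the inverse of `u t`, so this multiple of row `t` accounts for the entry -z
      -- y at `v t` and leaves -z y (w t) at `v (suc t)`.
      ≡⟨ Det-rowOperation (R t) ms (lastRow z y t) q' (-ω (z *ω y *ω conj (u t))) rs shift (v t ∷ ds) ⟩
    Det (R t ∷ ms ++ q' ∷ rs) (v t ∷ ds)
      ≡⟨ Det-pivot (R t) (ms ++ q' ∷ rs) (v t) ds (Allₚ.++⁺ ms-zero (q'-zero ∷ rs-zero t t≤l)) ⟩
    R t (v t) *ω Det (ms ++ q' ∷ rs) ds
      ≡⟨ cong₂ _*ω_ pivot (reduce s (suc t) z (y *ω w t) (≡.trans (≡.sym (ℕₚ.+-suc t s)) p)) ⟩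
    u t *ω (U *ω (z *ω (1ω -ω y *ω w t *ω W) *ω Det rs cs))
      ≡⟨ regroup (u t) U z y (w t) W (Det rs cs) ⟩
    u t *ω U *ω (z *ω (1ω -ω y *ω (w t *ω W)) *ω Det rs cs) ∎
    where
    open ≡-Reasoning
    ms = segment R (suc t) s
    ds = segment v (suc t) s ++ v l ∷ cs
    q' = lastRow z (y *ω w t) (suc t)
    U = productω (segment u (suc t) s)
    W = productω (segment w (suc t) s)
    t<l : t ℕ.< l
    t<l = ℕₚ.≤-trans (ℕₚ.m<m+n t ℕ.z<s) (ℕₚ.≤-reflexive p)
    t≤l = ℕₚ.<⇒≤ t<l
    regroup : ∀ a b z y w x d → a *ω (b *ω (z *ω (1ω -ω y *ω w *ω x) *ω d)) ≡ a *ω b *ω (z *ω (1ω -ω y *ω (w *ω x)) *ω d)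
    regroup = solve-∀ ℤω-acr
    step : ∀ z y w a b c → z *ω (a -ω y *ω (1ω *ω b)) ≡ z *ω (a -ω y *ω w *ω c) +ω (-ω (z *ω y)) *ω (b -ω w *ω c)
    step = solve-∀ ℤω-acr
    step₂ : ∀ z y u ū b → (-ω (z *ω y *ω ū)) *ω (u *ω b) ≡ (u *ω ū) *ω ((-ω (z *ω y)) *ω b)
    step₂ = solve-∀ ℤω-acr
    shift : ∀ c → lastRow z y t c ≡ q' c +ω (-ω (z *ω y *ω conj (u t))) *ω R t c
    shift c = ≡.sym (≡.trans (cong (λ r → q' c +ω (-ω (z *ω y *ω conj (u t))) *ω r) (R-shape t c))
      (≡.trans (cong (q' c +ω_) (≡.trans (step₂ z y (u t) (conj (u t)) (δ (v t) c -ω w t *ω δ (v (suc t)) c))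
        (≡.trans (cong (_*ω ((-ω (z *ω y)) *ω (δ (v t) c -ω w t *ω δ (v (suc t)) c))) (u-unit t))
                 (*ω-identityˡ ((-ω (z *ω y)) *ω (δ (v t) c -ω w t *ω δ (v (suc t)) c))))))
      (≡.trans (≡.sym (step z y (w t) (δ (v l) c) (δ (v t) c) (δ (v (suc t)) c)))
               (cong (λ d → z *ω (δ (v l) c -ω y *ω d)) (*ω-identityˡ (δ (v t) c))))))
    pivot : R t (v t) ≡ u t
    pivot = ≡.trans (R-shape t (v t)) (≡.trans (cong₂ (λ a b → u t *ω (a -ω w t *ω b)) (δ-refl (v t)) (δ-zero (ℕₚ.n<1+n t) t<l)) (eq (u t) (w t)))
      where
      eq : ∀ u w → u *ω (1ω -ω w *ω 0ω) ≡ u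
      eq = solve-∀ ℤω-acr
    zeros : ∀ a b → a *ω (0ω -ω b *ω 0ω) ≡ 0ω
    zeros = solve-∀ ℤω-acr
    q'-zero : q' (v t) ≡ 0ω
    q'-zero = ≡.trans (cong₂ (λ a b → z *ω (a -ω y *ω w t *ω b)) (δ-zero t<l ℕₚ.≤-refl) (δ-zero (ℕₚ.n<1+n t) t<l)) (zeros z (y *ω w t))
    ms-zero : All (λ r → r (v t) ≡ 0ω) ms
    ms-zero = segment-All R (suc t) s λ i t<i i<l →
      let i<l' = ℕₚ.≤-trans i<l (ℕₚ.≤-reflexive (≡.trans (≡.sym (ℕₚ.+-suc t s)) p)) in
      ≡.trans (R-shape i (v t)) (≡.trans (cong₂ (λ a b → u i *ω (a -ω w i *ω b)) (δ-zero t<i (ℕₚ.<⇒≤ i<l')) (δ-zero (ℕₚ.m<n⇒m<1+n t<i) i<l')) (zeros (u i) (w i)))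

  private
    units : ∀ t s → Unit (productω (segment u t s))
    units t zero    = ≡.refl
    units t (suc s) = unit-* (u t) (productω (segment u (suc t) s)) (u-unit t) (units (suc t) s)

  -- As `v (suc l)` is `v 0`, row `l` is already a `lastRow` with second entry at `v 0` and weight
  -- `w l`; the full reduction leaves 1 minus the monodromy.
  normω-Det-cycle : v (suc l) ≡ v 0 →
    normω (Det (segment R 0 l ++ R l ∷ rs) (segment v 0 l ++ v l ∷ cs))
    ≡ normω (1ω -ω w l *ω productω (segment w 0 l)) *ω normω (Det rs cs)
  normω-Det-cycle closed = ≡.trans (cong normω
      (≡.trans (Det-rowLast (segment R 0 l) (λ c → ≡.trans (R-shape l c) (cong (λ a → u l *ω (δ (v l) c -ω w l *ω δ a c)) closed)) (segment v 0 l ++ v l ∷ cs))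
               (reduce l 0 (u l) (w l) ≡.refl)))
    (≡.trans (unit-absorb (productω (segment u 0 l)) (u l *ω (1ω -ω w l *ω productω (segment w 0 l)) *ω Det rs cs) (units 0 l) ≡.refl)
    (≡.trans (unit-absorb (u l) ((1ω -ω w l *ω productω (segment w 0 l)) *ω Det rs cs) (u-unit l)
               (*ω-assoc (u l) (1ω -ω w l *ω productω (segment w 0 l)) (Det rs cs)))
             (normω-* (1ω -ω w l *ω productω (segment w 0 l)) (Det rs cs))))
    where
    Det-rowLast : ∀ ms {q q' : Fin K → ℤω} → (∀ c → q c ≡ q' c) → ∀ ds → Det (ms ++ q ∷ rs) ds ≡ Det (ms ++ q' ∷ rs) ds
    Det-rowLast []       p ds = expand-cong p (λ _ → ≡.refl) ds
    Det-rowLast (m ∷ ms) p ds = expand-congʰ m (Det-rowLast ms p) ds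

-- The factorisation of the Laplacian

sumω-concatMap : (g : X → List Y) (xs : List X) (f : Y → ℤω) → sumω (concatMap g xs) f ≡ sumω xs (λ x → sumω (g x) f)
sumω-concatMap g []       f = ≡.refl
sumω-concatMap g (x ∷ xs) f = ≡.trans (sumω-++ (g x) (concatMap g xs) f) (cong (sumω (g x) f +ω_) (sumω-concatMap g xs f))

sumω-+ : (xs : List X) (f g : X → ℤω) → sumω xs (λ x → f x +ω g x) ≡ sumω xs f +ω sumω xs g
sumω-+ []       f g = ≡.refl
sumω-+ (x ∷ xs) f g = ≡.trans (cong (f x +ω g x +ω_) (sumω-+ xs f g)) (eq (f x) (g x) (sumω xs f) (sumω xs g))
  where
  eq : ∀ a b c d → a +ω b +ω (c +ω d) ≡ a +ω c +ω (b +ω d)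
  eq = solve-∀ ℤω-acr

sumω-* : (xs : List X) (a : ℤω) (f : X → ℤω) → sumω xs (λ x → a *ω f x) ≡ a *ω sumω xs f
sumω-* []       a f = eq a
  where
  eq : ∀ a → 0ω ≡ a *ω 0ω
  eq = solve-∀ ℤω-acr
sumω-* (x ∷ xs) a f = ≡.trans (cong (a *ω f x +ω_) (sumω-* xs a f)) (eq a (f x) (sumω xs f))
  where
  eq : ∀ a x y → a *ω x +ω a *ω y ≡ a *ω (x +ω y)
  eq = solve-∀ ℤω-acr

sumω-zero : (xs : List X) → sumω xs (λ _ → 0ω) ≡ 0ω
sumω-zero []       = ≡.refl
sumω-zero (x ∷ xs) = cong (0ω +ω_) (sumω-zero xs)

sumω-comm : (xs : List X) (ys : List Y) (f : X → Y → ℤω) →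
            sumω xs (λ x → sumω ys (f x)) ≡ sumω ys (λ y → sumω xs (λ x → f x y))
sumω-comm []       ys f = ≡.sym (sumω-zero ys)
sumω-comm (x ∷ xs) ys f = ≡.trans (cong (sumω ys (f x) +ω_) (sumω-comm xs ys f))
  (≡.sym (sumω-+ ys (f x) (λ y → sumω xs (λ x → f x y))))

sumω-δ : ∀ {n} (p : Fin n) (f : Fin n → ℤω) → sumω (allFin n) (λ i → δ i p *ω f i) ≡ f p
sumω-δ {n} p f = ≡.trans (tab n id (λ i → δ i p *ω f i)) (go p f)
  where
  tab : ∀ k (g : Fin k → X) (h : X → ℤω) → sumω (tabulate g) h ≡ sumFin k (h ∘ g)
  tab zero    g h = ≡.refl
  tab (suc k) g h = cong (h (g zero) +ω_) (tab k (g ∘ suc) h)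
  eq₀ : ∀ x → 1ω *ω x +ω 0ω ≡ x
  eq₀ = solve-∀ ℤω-acr
  eq₁ : ∀ x y → 0ω *ω x +ω y ≡ y
  eq₁ = solve-∀ ℤω-acr
  eq₂ : ∀ x → 0ω *ω x ≡ 0ω
  eq₂ = solve-∀ ℤω-acr
  zeros : ∀ k → sumFin k (λ _ → 0ω) ≡ 0ω
  zeros zero    = ≡.refl
  zeros (suc k) = cong (0ω +ω_) (zeros k)
  go : ∀ {k} (p : Fin k) (f : Fin k → ℤω) → sumFin k (λ i → δ i p *ω f i) ≡ f p
  go {suc k} zero    f = ≡.trans (cong (1ω *ω f zero +ω_) (≡.trans (sumFin-cong k (λ i → eq₂ (f (suc i)))) (zeros k))) (eq₀ (f zero))
  go {suc k} (suc p) f = ≡.trans (cong (0ω *ω f zero +ω_) (go p (f ∘ suc))) (eq₁ (f zero) (f (suc p)))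

fromℕω-sum : ∀ (xs : List X) (f : X → ℕ) → fromℕω (sum (map f xs)) ≡ sumω xs (fromℕω ∘ f)
fromℕω-sum []       f = ≡.refl
fromℕω-sum (x ∷ xs) f = cong (fromℕω (f x) +ω_) (fromℕω-sum xs f)

conj-δ : ∀ {n} (a b : Fin n) → conj (δ a b) ≡ δ a b
conj-δ a b with does (a Fin.≟ b)
... | true  = ≡.refl
... | false = ≡.refl

conj-nEntry : ∀ κ → conj (nEntry κ) ≡ nEntry (rev κ)
conj-nEntry none  = ≡.refl
conj-nEntry undir = ≡.refl
conj-nEntry out   = ≡.refl
conj-nEntry inc   = ≡.refl

unit-nEntry : ∀ κ → κ ≢ none → Unit (nEntry κ)
unit-nEntry none  p = contradiction ≡.refl p
unit-nEntry undir p = ≡.refl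
unit-nEntry out   p = ≡.refl
unit-nEntry inc   p = ≡.refl

-- The entry at `j` is chosen so that the entry at `i` times its conjugate is -n_ij.
incidence : ∀ {n} → MixedGraph n → Edge n → Fin n → ℤω
incidence G (i , j) p = δ i p -ω nEntry (kind G j i) *ω δ j p

module _ {n} (G : MixedGraph n) where

  private
    ind : Fin n → Fin n → ℕ
    ind i j = if isEdge (kind G i j) then 1 else 0

    -- An edge contributes endTerm i j + endTerm j i, so the sum over i < j becomes a sum over all ordered pairs.
    contribution : Fin n → Fin n → Fin n → ℤω
    contribution q i j = fromℕω (ind i j) *ω δ i q -ω nEntry (kind G i j) *ω δ j q

    endTerm : Fin n → Fin n → Fin n → Fin n → ℤω
    endTerm p q i j = δ i p *ω contribution q i j

    edgeTerm : ∀ p q i j → kind G i j ≢ none →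
      incidence G (i , j) p *ω conj (incidence G (i , j) q) ≡ endTerm p q i j +ω endTerm p q j i
    edgeTerm p q i j e = begin
      (δ i p -ω n̄ *ω δ j p) *ω conj (δ i q -ω n̄ *ω δ j q)
        ≡⟨ cong ((δ i p -ω n̄ *ω δ j p) *ω_) conj-eq ⟩
      (δ i p -ω n̄ *ω δ j p) *ω (δ i q -ω conj n̄ *ω δ j q)
        ≡⟨ eq (δ i p) (δ j p) (δ i q) (δ j q) n̄ (conj n̄) ⟩
      δ i p *ω (1ω *ω δ i q -ω conj n̄ *ω δ j q) +ω δ j p *ω (normω n̄ *ω δ j q -ω n̄ *ω δ i q)
        ≡⟨ cong₂ (λ a b → δ i p *ω (1ω *ω δ i q -ω a *ω δ j q) +ω δ j p *ω (b *ω δ j q -ω n̄ *ω δ i q)) n̄-conj (unit-nEntry (kind G j i) e') ⟩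
      δ i p *ω (1ω *ω δ i q -ω nEntry (kind G i j) *ω δ j q) +ω δ j p *ω (1ω *ω δ j q -ω n̄ *ω δ i q)
        ≡⟨ cong₂ (λ a b → δ i p *ω (fromℕω a *ω δ i q -ω nEntry (kind G i j) *ω δ j q) +ω δ j p *ω (fromℕω b *ω δ j q -ω n̄ *ω δ i q)) (ind-edge i j e) (ind-edge j i e') ⟨
      endTerm p q i j +ω endTerm p q j i ∎
      where
      open ≡-Reasoning
      n̄ = nEntry (kind G j i)
      ind-edge : ∀ i j → kind G i j ≢ none → ind i j ≡ 1
      ind-edge i j e with kind G i j
      ... | none  = contradiction ≡.refl e
      ... | undir = ≡.refl
      ... | out   = ≡.refl
      ... | inc   = ≡.refl
      e' : kind G j i ≢ none
      e' z = e (≡.trans (symmetric G j i) (cong rev z))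
      n̄-conj : conj n̄ ≡ nEntry (kind G i j)
      n̄-conj = ≡.trans (conj-nEntry (kind G j i)) (cong nEntry (≡.sym (symmetric G j i)))
      conj-eq : conj (δ i q -ω n̄ *ω δ j q) ≡ δ i q -ω conj n̄ *ω δ j q
      conj-eq = ≡.trans (conj-+ (δ i q) (-ω (n̄ *ω δ j q))) (cong₂ _+ω_ (conj-δ i q)
        (≡.trans (conj-neg (n̄ *ω δ j q)) (cong (λ x → -ω x) (≡.trans (conj-* n̄ (δ j q)) (cong (conj n̄ *ω_) (conj-δ j q))))))
      eq : ∀ a b c d n m → (a -ω n *ω b) *ω (c -ω m *ω d) ≡ a *ω (1ω *ω c -ω m *ω d) +ω b *ω (n *ω m *ω d -ω n *ω c)
      eq = solve-∀ ℤω-acr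

    nonEdgeTerm : ∀ p q i j → kind G i j ≡ none → endTerm p q i j ≡ 0ω
    nonEdgeTerm p q i j e rewrite e = eq (δ i p) (δ i q) (δ j q)
      where
      eq : ∀ a b c → a *ω (0ω *ω b -ω 0ω *ω c) ≡ 0ω
      eq = solve-∀ ℤω-acr

    below : Fin n → Fin n → ℤω → ℤω
    below i j x = if toℕ i ℕ.<ᵇ toℕ j then x else 0ω

    below-+ : ∀ i j x y → below i j (x +ω y) ≡ below i j x +ω below i j y
    below-+ i j x y with toℕ i ℕ.<ᵇ toℕ j
    ... | true  = ≡.refl
    ... | false = ≡.refl

    below-true : ∀ i j x → toℕ i ℕ.< toℕ j → below i j x ≡ x
    below-true i j x p with toℕ i ℕ.<ᵇ toℕ j in eq
    ... | true  = ≡.refl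
    ... | false = contradiction (subst T eq (ℕₚ.<⇒<ᵇ p)) λ ()

    below-false : ∀ i j x → ¬ (toℕ i ℕ.< toℕ j) → below i j x ≡ 0ω
    below-false i j x p with toℕ i ℕ.<ᵇ toℕ j in eq
    ... | true  = contradiction (ℕₚ.<ᵇ⇒< (toℕ i) (toℕ j) (subst T (≡.sym eq) _)) p
    ... | false = ≡.refl

    blockTerm : ∀ p q i j →
      sumω (if isEdge (kind G i j) ∧ (toℕ i ℕ.<ᵇ toℕ j) then (i , j) ∷ [] else []) (λ e → incidence G e p *ω conj (incidence G e q))
      ≡ below i j (endTerm p q i j) +ω below i j (endTerm p q j i)
    blockTerm p q i j = ≡.trans (go (kind G i j) ≡.refl) (below-+ i j (endTerm p q i j) (endTerm p q j i))
      where
      f : Edge n → ℤω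
      f e = incidence G e p *ω conj (incidence G e q)
      +0 : ∀ x → x +ω 0ω ≡ x
      +0 = solve-∀ ℤω-acr
      edge-case : kind G i j ≢ none → sumω (if toℕ i ℕ.<ᵇ toℕ j then (i , j) ∷ [] else []) f ≡ below i j (endTerm p q i j +ω endTerm p q j i)
      edge-case e with toℕ i ℕ.<ᵇ toℕ j
      ... | true  = ≡.trans (+0 (f (i , j))) (edgeTerm p q i j e)
      ... | false = ≡.refl
      below-zero : below i j 0ω ≡ 0ω
      below-zero with toℕ i ℕ.<ᵇ toℕ j
      ... | true  = ≡.refl
      ... | false = ≡.refl
      go : ∀ κ → kind G i j ≡ κ → sumω (if isEdge κ ∧ (toℕ i ℕ.<ᵇ toℕ j) then (i , j) ∷ [] else []) f
         ≡ below i j (endTerm p q i j +ω endTerm p q j i)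
      go none  e = ≡.sym (≡.trans (cong (below i j) (cong₂ _+ω_ (nonEdgeTerm p q i j e)
                     (nonEdgeTerm p q j i (≡.trans (symmetric G i j) (cong rev e))))) below-zero)
      go undir e = edge-case λ z → contradiction (≡.trans (≡.sym e) z) λ ()
      go out   e = edge-case λ z → contradiction (≡.trans (≡.sym e) z) λ ()
      go inc   e = edge-case λ z → contradiction (≡.trans (≡.sym e) z) λ ()

    below-total : ∀ p q i j → below i j (endTerm p q i j) +ω below j i (endTerm p q i j) ≡ endTerm p q i j
    below-total p q i j with ℕₚ.<-cmp (toℕ i) (toℕ j)
    ... | tri< a _ c = ≡.trans (cong₂ _+ω_ (below-true i j (endTerm p q i j) a) (below-false j i (endTerm p q i j) c)) (eq (endTerm p q i j))
      where
      eq : ∀ x → x +ω 0ω ≡ x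
      eq = solve-∀ ℤω-acr
    ... | tri> a _ c = ≡.trans (cong₂ _+ω_ (below-false i j (endTerm p q i j) a) (below-true j i (endTerm p q i j) c)) (eq (endTerm p q i j))
      where
      eq : ∀ x → 0ω +ω x ≡ x
      eq = solve-∀ ℤω-acr
    ... | tri≈ a b c = ≡.trans (cong₂ _+ω_ (below-false i j (endTerm p q i j) a) (below-false j i (endTerm p q i j) c))
      (≡.sym (nonEdgeTerm p q i j (subst (λ x → kind G i x ≡ none) (Finₚ.toℕ-injective b) (loopless G i))))

  Lap-factorisation : ∀ p q → sumω (edges G) (λ e → incidence G e p *ω conj (incidence G e q)) ≡ Lap G p q
  Lap-factorisation p q = begin
    sumω (edges G) f
      ≡⟨ sumω-concatMap _ (allFin n) f ⟩
    sumω (allFin n) (λ i → sumω (concatMap _ (allFin n)) f)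
      ≡⟨ sumω-cong (allFin n) (λ i → ≡.trans (sumω-concatMap _ (allFin n) f) (≡.trans (sumω-cong (allFin n) (blockTerm p q i))
           (sumω-+ (allFin n) (λ j → below i j (endTerm p q i j)) (λ j → below i j (endTerm p q j i))))) ⟩
    sumω (allFin n) (λ i → sumω (allFin n) (λ j → below i j (endTerm p q i j)) +ω sumω (allFin n) (λ j → below i j (endTerm p q j i)))
      ≡⟨ sumω-+ (allFin n) (λ i → sumω (allFin n) (λ j → below i j (endTerm p q i j))) (λ i → sumω (allFin n) (λ j → below i j (endTerm p q j i))) ⟩
    S₁ +ω sumω (allFin n) (λ i → sumω (allFin n) (λ j → below i j (endTerm p q j i)))
      -- Exchanging the summation indices in the second sum turns i < j into j < i, so that the two
      -- sums together run over all ordered pairs.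
      ≡⟨ cong (S₁ +ω_) (sumω-comm (allFin n) (allFin n) (λ i j → below i j (endTerm p q j i))) ⟩
    S₁ +ω S₂
      ≡⟨ sumω-+ (allFin n) (λ i → sumω (allFin n) (λ j → below i j (endTerm p q i j))) (λ i → sumω (allFin n) (λ j → below j i (endTerm p q i j))) ⟨
    sumω (allFin n) (λ i → sumω (allFin n) (λ j → below i j (endTerm p q i j)) +ω sumω (allFin n) (λ j → below j i (endTerm p q i j)))
      ≡⟨ sumω-cong (allFin n) (λ i → ≡.trans (≡.sym (sumω-+ (allFin n) (λ j → below i j (endTerm p q i j)) (λ j → below j i (endTerm p q i j))))
           (≡.trans (sumω-cong (allFin n) (below-total p q i)) (sumω-* (allFin n) (δ i p) (contribution q i)))) ⟩
    sumω (allFin n) (λ i → δ i p *ω sumω (allFin n) (contribution q i))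
      ≡⟨ sumω-δ p (λ i → sumω (allFin n) (contribution q i)) ⟩
    sumω (allFin n) (contribution q p)
      ≡⟨ sumω-cong (allFin n) (λ j → eq (fromℕω (ind p j)) (δ p q) (nEntry (kind G p j)) (δ j q)) ⟩
    sumω (allFin n) (λ j → δ p q *ω fromℕω (ind p j) +ω δ j q *ω (-ω nEntry (kind G p j)))
      ≡⟨ sumω-+ (allFin n) (λ j → δ p q *ω fromℕω (ind p j)) (λ j → δ j q *ω (-ω nEntry (kind G p j))) ⟩
    sumω (allFin n) (λ j → δ p q *ω fromℕω (ind p j)) +ω sumω (allFin n) (λ j → δ j q *ω (-ω nEntry (kind G p j)))
      ≡⟨ cong₂ _+ω_ (≡.trans (sumω-* (allFin n) (δ p q) (λ j → fromℕω (ind p j)))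
           (≡.trans (cong (δ p q *ω_) (≡.sym (fromℕω-sum (allFin n) (ind p)))) diagonal))
           (sumω-δ q (λ j → -ω nEntry (kind G p j))) ⟩
    Lap G p q ∎
    where
    open ≡-Reasoning
    f : Edge n → ℤω
    f e = incidence G e p *ω conj (incidence G e q)
    S₁ = sumω (allFin n) (λ i → sumω (allFin n) (λ j → below i j (endTerm p q i j)))
    S₂ = sumω (allFin n) (λ i → sumω (allFin n) (λ j → below j i (endTerm p q i j)))
    eq : ∀ a b c d → a *ω b -ω c *ω d ≡ b *ω a +ω d *ω (-ω c)
    eq = solve-∀ ℤω-acr
    eq₀ : ∀ a → 0ω *ω a ≡ 0ω
    eq₀ = solve-∀ ℤω-acr
    diagonal : δ p q *ω fromℕω (degree G p) ≡ diagEntry G p q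
    diagonal with p Fin.≟ q
    ... | yes _ = *ω-identityˡ (fromℕω (degree G p))
    ... | no _  = eq₀ (fromℕω (degree G p))

-- The edge list and its sublists

Proper : ∀ {n} → MixedGraph n → Edge n → Set
Proper G (i , j) = kind G i j ≢ none × toℕ i ℕ.< toℕ j

private
  block : ∀ {n} (G : MixedGraph n) → Fin n → Fin n → List (Edge n)
  block G i j = if isEdge (kind G i j) ∧ (toℕ i ℕ.<ᵇ toℕ j) then (i , j) ∷ [] else []

  block-∈ : ∀ {n} (G : MixedGraph n) i j {e} → e ∈ block G i j → e ≡ (i , j) × Proper G (i , j)
  block-∈ G i j p with kind G i j | toℕ i ℕ.<ᵇ toℕ j in eq
  block-∈ G i j (here ≡.refl) | undir | true = ≡.refl , (λ ()) , ℕₚ.<ᵇ⇒< (toℕ i) (toℕ j) (subst T (≡.sym eq) _)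
  block-∈ G i j (here ≡.refl) | out   | true = ≡.refl , (λ ()) , ℕₚ.<ᵇ⇒< (toℕ i) (toℕ j) (subst T (≡.sym eq) _)
  block-∈ G i j (here ≡.refl) | inc   | true = ≡.refl , (λ ()) , ℕₚ.<ᵇ⇒< (toℕ i) (toℕ j) (subst T (≡.sym eq) _)

  block-unique : ∀ {n} (G : MixedGraph n) i j → Unique (block G i j)
  block-unique G i j with isEdge (kind G i j) ∧ (toℕ i ℕ.<ᵇ toℕ j)
  ... | true  = [] ∷ []
  ... | false = []

-- `key` recovers from an element the index of its block, so blocks of distinct indices are
-- disjoint.
concatMap-unique : (key : Y → X) (g : X → List Y) → (∀ x {y} → y ∈ g x → key y ≡ x) → (∀ x → Unique (g x)) →
                   ∀ {xs} → Unique xs → Unique (concatMap g xs)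
concatMap-unique key g key-g g-unique []         = []
concatMap-unique key g key-g g-unique {x ∷ xs} (x∉ ∷ xs!) =
  Uniqueₚ.++⁺ (g-unique x) (concatMap-unique key g key-g g-unique xs!) disjoint
  where
  disjoint : ∀ {y} → ¬ (y ∈ g x × y ∈ concatMap g xs)
  disjoint (p , q) with find (∈ₚ.∈-concatMap⁻ g {xs = xs} q)
  ... | z , z∈xs , y∈gz = All.lookup x∉ z∈xs (≡.trans (≡.sym (key-g x p)) (key-g z y∈gz))

edges-proper : ∀ {n} (G : MixedGraph n) {e} → e ∈ edges G → Proper G e
edges-proper {n} G p with find (∈ₚ.∈-concatMap⁻ (λ i → concatMap (block G i) (allFin n)) {xs = allFin n} p)
... | i , _ , q with find (∈ₚ.∈-concatMap⁻ (block G i) {xs = allFin n} q)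
...   | j , _ , r with block-∈ G i j r
...     | ≡.refl , proper = proper

edges-unique : ∀ {n} (G : MixedGraph n) → Unique (edges G)
edges-unique {n} G = concatMap-unique proj₁ (λ i → concatMap (block G i) (allFin n)) keys
  (λ i → concatMap-unique proj₂ (block G i) (λ j p → cong proj₂ (proj₁ (block-∈ G i j p))) (block-unique G i) (Uniqueₚ.allFin⁺ n))
  (Uniqueₚ.allFin⁺ n)
  where
  keys : ∀ i {e} → e ∈ concatMap (block G i) (allFin n) → proj₁ e ≡ i
  keys i p with find (∈ₚ.∈-concatMap⁻ (block G i) {xs = allFin n} p)
  ... | j , _ , q = cong proj₁ (proj₁ (block-∈ G i j q))

sublists-All : {P : X → Set} {xs : List X} → All P xs → ∀ {ys} → ys ∈ sublists xs → All P ys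
sublists-All []                 (here ≡.refl) = []
sublists-All {xs = x ∷ xs} (p ∷ ps) q with ∈ₚ.∈-++⁻ (map (x ∷_) (sublists xs)) q
... | inj₂ r = sublists-All ps r
... | inj₁ r with ∈ₚ.∈-map⁻ (x ∷_) r
...   | zs , zs∈ , ≡.refl = p ∷ sublists-All ps zs∈

sublists-Unique : {xs : List X} → Unique xs → ∀ {ys} → ys ∈ sublists xs → Unique ys
sublists-Unique []                 (here ≡.refl) = []
sublists-Unique {xs = x ∷ xs} (p ∷ ps) q with ∈ₚ.∈-++⁻ (map (x ∷_) (sublists xs)) q
... | inj₂ r = sublists-Unique ps r
... | inj₁ r with ∈ₚ.∈-map⁻ (x ∷_) r
...   | zs , zs∈ , ≡.refl = sublists-All p zs∈ ∷ sublists-Unique ps zs∈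

-- Cauchy-Binet for S S*, whose second factor consists of the conjugate rows. Sublists of every size
-- still occur in the sum.
det-principal : ∀ {n K} (G : MixedGraph n) (ι : Fin K → Fin n) →
  det K (principal G ι) ≡ sumω (sublists (edges G)) (λ F → normω (Det (map (λ e a → incidence G e (ι a)) F) (allFin K)))
det-principal {n} {K} G ι = begin
  det K (principal G ι)
    ≡⟨ det≡Det K (principal G ι) id ⟩
  Det (tabulate (principal G ι)) (allFin K)
    ≡⟨ cong (λ rs → Det rs (allFin K)) (Listₚ.map-tabulate id (principal G ι)) ⟨
  Det (map (principal G ι) (allFin K)) (allFin K)
    ≡⟨ Det-cong (principal G ι) _ (λ a b → ≡.sym (Lap-factorisation G (ι a) (ι b))) (allFin K) (allFin K) ⟩
  Det (map (λ a b → sumω (edges G) (λ e → row e a *ω conj (row e b))) (allFin K)) (allFin K)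
    ≡⟨ cauchyBinet row (λ e b → conj (row e b)) (edges G) (allFin K) (allFin K) ⟩
  sumω (sublists (edges G)) (λ F → Det (map row F) (allFin K) *ω Det (map (λ e b → conj (row e b)) F) (allFin K))
    ≡⟨ sumω-cong (sublists (edges G)) (λ F → cong (Det (map row F) (allFin K) *ω_) (Det-conj row F (allFin K))) ⟩
  sumω (sublists (edges G)) (λ F → normω (Det (map row F) (allFin K))) ∎
  where
  open ≡-Reasoning
  row : Edge n → Fin K → ℤω
  row e a = incidence G e (ι a)

sumω-filter : {P : X → Set} (P? : ∀ x → Dec (P x)) (xs : List X) (f : X → ℤω) → (∀ x → ¬ P x → f x ≡ 0ω) →
              sumω xs f ≡ sumω (filter P? xs) f
sumω-filter P? []       f z = ≡.refl
sumω-filter P? (x ∷ xs) f z with P? x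
... | yes _ = cong (f x +ω_) (sumω-filter P? xs f z)
... | no ¬p = ≡.trans (cong₂ _+ω_ (z x ¬p) (sumω-filter P? xs f z)) (eq (sumω (filter P? xs) f))
  where
  eq : ∀ x → 0ω +ω x ≡ x
  eq = solve-∀ ℤω-acr

sumω-cong-∈ : (xs : List X) {f g : X → ℤω} → (∀ x → x ∈ xs → f x ≡ g x) → sumω xs f ≡ sumω xs g
sumω-cong-∈ []       p = ≡.refl
sumω-cong-∈ (x ∷ xs) p = cong₂ _+ω_ (p x (here ≡.refl)) (sumω-cong-∈ xs (λ y → p y ∘ there))

-- Powers of ω

*ω-comm : ∀ x y → x *ω y ≡ y *ω x
*ω-comm = solve-∀ ℤω-acr

-- ω̄ ^ z
expω : ℤ → ℤω
expω (+ zero)       = 1ω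
expω (+ suc n)      = ω̄ *ω expω (+ n)
expω -[1+ zero ]    = ω
expω -[1+ suc n ]   = ω *ω expω -[1+ n ]

private
  cancel : ∀ a b x → a *ω b ≡ 1ω → a *ω (b *ω x) ≡ x
  cancel a b x p = ≡.trans (≡.sym (*ω-assoc a b x)) (≡.trans (cong (_*ω x) p) (*ω-identityˡ x))

  expω-suc : ∀ z → expω (+ 1 ℤ.+ z) ≡ ω̄ *ω expω z
  expω-suc (+ n)          = ≡.refl
  expω-suc -[1+ zero ]    = ≡.refl
  expω-suc -[1+ suc n ]   = ≡.sym (cancel ω̄ ω (expω -[1+ n ]) ≡.refl)

  expω-pred : ∀ z → expω (-[1+ 0 ] ℤ.+ z) ≡ ω *ω expω z
  expω-pred (+ zero)    = ≡.refl
  expω-pred (+ suc n)   = ≡.sym (cancel ω ω̄ (expω (+ n)) ≡.refl)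
  expω-pred -[1+ n ]    = ≡.refl

expω-+ : ∀ y z → expω (y ℤ.+ z) ≡ expω y *ω expω z
expω-+ (+ zero) z = ≡.trans (cong expω (ℤₚ.+-identityˡ z)) (≡.sym (*ω-identityˡ (expω z)))
expω-+ (+ suc n) z = ≡.trans (cong expω (ℤₚ.+-assoc (+ 1) (+ n) z)) (≡.trans (expω-suc (+ n ℤ.+ z))
  (≡.trans (cong (ω̄ *ω_) (expω-+ (+ n) z)) (≡.sym (*ω-assoc ω̄ (expω (+ n)) (expω z)))))
expω-+ -[1+ zero ] z = expω-pred z
expω-+ -[1+ suc n ] z = ≡.trans (cong expω (ℤₚ.+-assoc -[1+ 0 ] -[1+ n ] z)) (≡.trans (expω-pred (-[1+ n ] ℤ.+ z))
  (≡.trans (cong (ω *ω_) (expω-+ -[1+ n ] z)) (≡.sym (*ω-assoc ω (expω -[1+ n ]) (expω z)))))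

-- ω̄ is a sixth root of unity: with z = r + 6q, the factor for 6q is the square of the cube of
-- `expω q`, which `sixth` shows to be 1.
expω-%ℕ : ∀ z → expω z ≡ expω (+ (z ℤ.%ℕ 6))
expω-%ℕ z = begin
  expω z                                    ≡⟨ cong expω (ℤDM.a≡a%ℕn+[a/ℕn]*n z 6) ⟩
  expω (+ r ℤ.+ q ℤ.* + 6)                  ≡⟨ expω-+ (+ r) (q ℤ.* + 6) ⟩
  expω (+ r) *ω expω (q ℤ.* + 6)            ≡⟨ cong (λ x → expω (+ r) *ω expω x) (sextuple q) ⟩
  expω (+ r) *ω expω (q₃ ℤ.+ q₃)            ≡⟨ cong (expω (+ r) *ω_) (expω-+ q₃ q₃) ⟩
  expω (+ r) *ω power2 (expω q₃)            ≡⟨ cong (λ x → expω (+ r) *ω power2 x) (cube q) ⟩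
  expω (+ r) *ω power2 (power3 (expω q))    ≡⟨ cong (expω (+ r) *ω_) (sixth q) ⟩
  expω (+ r) *ω 1ω                          ≡⟨ *ω-comm (expω (+ r)) 1ω ⟩
  1ω *ω expω (+ r)                          ≡⟨ *ω-identityˡ (expω (+ r)) ⟩
  expω (+ r)                                ∎
  where
  open ≡-Reasoning
  r = z ℤ.%ℕ 6
  q = z ℤ./ℕ 6
  q₃ = q ℤ.+ q ℤ.+ q
  sextuple : ∀ q → q ℤ.* + 6 ≡ q ℤ.+ q ℤ.+ q ℤ.+ (q ℤ.+ q ℤ.+ q)
  sextuple = ℤ-solve-∀
  power2 power3 : ℤω → ℤω
  power2 x = x *ω x
  power3 x = x *ω x *ω x
  power2-* : ∀ x y → (x *ω y) *ω (x *ω y) ≡ (x *ω x) *ω (y *ω y)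
  power2-* = solve-∀ ℤω-acr
  power3-* : ∀ x y → (x *ω y) *ω (x *ω y) *ω (x *ω y) ≡ (x *ω x *ω x) *ω (y *ω y *ω y)
  power3-* = solve-∀ ℤω-acr
  cube : ∀ y → expω (y ℤ.+ y ℤ.+ y) ≡ power3 (expω y)
  cube y = ≡.trans (expω-+ (y ℤ.+ y) y) (cong (_*ω expω y) (expω-+ y y))
  sixth-step : ∀ x y → power2 (power3 x) ≡ 1ω → power2 (power3 y) ≡ 1ω → power2 (power3 (x *ω y)) ≡ 1ω
  sixth-step x y p q = ≡.trans (cong power2 (power3-* x y)) (≡.trans (power2-* (power3 x) (power3 y)) (cong₂ _*ω_ p q))
  sixth : ∀ q → power2 (power3 (expω q)) ≡ 1ω
  sixth (+ zero)       = ≡.refl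
  sixth (+ suc n)      = sixth-step ω̄ (expω (+ n)) ≡.refl (sixth (+ n))
  sixth -[1+ zero ]    = ≡.refl
  sixth -[1+ suc n ]   = sixth-step ω (expω -[1+ n ]) ≡.refl (sixth -[1+ n ])

-- |1 - ω^r|² for r < 6
cycleWeight : ℕ → ℕ
cycleWeight 0 = 0
cycleWeight 2 = 3
cycleWeight 3 = 4
cycleWeight 4 = 3
-- The default serves the residues 1 and 5.
cycleWeight _ = 1

normω-cycleWeight : ∀ r → r ℕ.< 6 → normω (1ω -ω expω (+ r)) ≡ fromℕω (cycleWeight r)
normω-cycleWeight 0 _ = ≡.refl
normω-cycleWeight 1 _ = ≡.refl
normω-cycleWeight 2 _ = ≡.refl
normω-cycleWeight 3 _ = ≡.refl
normω-cycleWeight 4 _ = ≡.refl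
normω-cycleWeight 5 _ = ≡.refl
normω-cycleWeight (suc (suc (suc (suc (suc (suc r)))))) r<6 = contradiction r<6 (ℕₚ.≤⇒≯ (ℕₚ.m≤m+n 6 r))

-- Segments of sequences

segment-snoc : (g : ℕ → X) (t s : ℕ) (xs : List X) → segment g t (suc s) ++ xs ≡ segment g t s ++ g (t ℕ.+ s) ∷ xs
segment-snoc g t zero    xs = cong (λ i → g i ∷ xs) (≡.sym (ℕₚ.+-identityʳ t))
segment-snoc g t (suc s) xs = cong (g t ∷_) (≡.trans (segment-snoc g (suc t) s xs)
  (cong (λ i → segment g (suc t) s ++ g i ∷ xs) (≡.sym (ℕₚ.+-suc t s))))

map-segment : (f : X → Y) (g : ℕ → X) (t s : ℕ) → map f (segment g t s) ≡ segment (f ∘ g) t s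
map-segment f g t zero    = ≡.refl
map-segment f g t (suc s) = cong (f (g t) ∷_) (map-segment f g (suc t) s)

segment-Unique : (g : ℕ → X) (t s : ℕ) → (∀ {i j} → i ℕ.< j → j ℕ.< t ℕ.+ s → g i ≢ g j) → Unique (segment g t s)
segment-Unique g t zero    p = []
segment-Unique g t (suc s) p =
  segment-All g (suc t) s (λ i t<i i< → p t<i (ℕₚ.≤-trans i< (ℕₚ.≤-reflexive (≡.sym (ℕₚ.+-suc t s)))))
  ∷ segment-Unique g (suc t) s (λ i<j j< → p i<j (ℕₚ.≤-trans j< (ℕₚ.≤-reflexive (≡.sym (ℕₚ.+-suc t s)))))

∈-segment⁺ : (g : ℕ → X) (s : ℕ) {i : ℕ} → i ℕ.< s → g i ∈ segment g 0 s
∈-segment⁺ g s {i} i<s = go 0 s i i<s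
  where
  go : ∀ t s i → i ℕ.< s → g (t ℕ.+ i) ∈ segment g t s
  go t (suc s) zero    p = here (cong g (ℕₚ.+-identityʳ t))
  go t (suc s) (suc i) (ℕ.s≤s p) = there (subst (λ x → g x ∈ segment g (suc t) s) (≡.sym (ℕₚ.+-suc t i)) (go (suc t) s i p))

∈-segment⁻ : (g : ℕ → X) (s : ℕ) {x : X} → x ∈ segment g 0 s → ∃[ i ] i ℕ.< s × x ≡ g i
∈-segment⁻ g s {x} = All.lookup (segment-All {P = λ y → ∃[ i ] i ℕ.< s × y ≡ g i} g 0 s (λ i _ i< → i , i< , ≡.refl))

tabulate-segment : ∀ r (f : Fin r → X) (g : ℕ → X) (t : ℕ) → (∀ x → f x ≡ g (t ℕ.+ toℕ x)) → tabulate f ≡ segment g t r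
tabulate-segment zero    f g t p = ≡.refl
tabulate-segment (suc r) f g t p = cong₂ _∷_ (≡.trans (p zero) (cong g (ℕₚ.+-identityʳ t)))
  (tabulate-segment r (f ∘ suc) g (suc t) (λ x → ≡.trans (p (suc x)) (cong g (ℕₚ.+-suc t (toℕ x)))))

productω-snoc : ∀ xs y → productω (xs ++ y ∷ []) ≡ y *ω productω xs
productω-snoc []       y = ≡.refl
productω-snoc (x ∷ xs) y = ≡.trans (cong (x *ω_) (productω-snoc xs y)) (eq x y (productω xs))
  where
  eq : ∀ x y z → x *ω (y *ω z) ≡ y *ω (x *ω z)
  eq = solve-∀ ℤω-acr

lookup-injective : {xs : List X} → Unique xs → ∀ i j → List.lookup xs i ≡ List.lookup xs j → i ≡ j
lookup-injective {xs = x ∷ xs} (p ∷ ps) zero    zero    q = ≡.refl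
lookup-injective {xs = x ∷ xs} (p ∷ ps) zero    (suc j) q = contradiction q (All.lookup p (∈ₚ.∈-lookup j))
lookup-injective {xs = x ∷ xs} (p ∷ ps) (suc i) zero    q = contradiction (≡.sym q) (All.lookup p (∈ₚ.∈-lookup i))
lookup-injective {xs = x ∷ xs} (p ∷ ps) (suc i) (suc j) q = cong suc (lookup-injective ps i j q)

-- Rows of the incidence matrix and edges of cycles

module IncidenceStructure {n k : ℕ} (G : MixedGraph n) (ι : Fin k → Fin n) (ι-inj : Injective _≡_ _≡_ ι)
           (E₁ : List (Edge n)) (E₁-proper : All (Proper G) E₁) (E₁-unique : Unique E₁) where
  open Substructure G ι E₁

  row : Fin m → Fin k → ℤω
  row e a = incidence G (edge e) (ι a)

  edge-proper : ∀ e → Proper G (edge e)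
  edge-proper e = All.lookup E₁-proper (∈ₚ.∈-lookup e)

  source≢target : ∀ e → proj₁ (edge e) ≢ proj₂ (edge e)
  source≢target e p = ℕₚ.<⇒≢ (proj₂ (edge-proper e)) (cong toℕ p)

  -- The unordered pair of ends, in the form used inside `FullAdj`, so that the edges of a `Cycle`
  -- provide it directly.
  Ends : Fin m → Fin k → Fin k → Set
  Ends e a b = ((proj₁ (edge e) ≡ ι a) × (proj₂ (edge e) ≡ ι b))
             ⊎ ((proj₁ (edge e) ≡ ι b) × (proj₂ (edge e) ≡ ι a))

  Ends-sym : ∀ {e a b} → Ends e a b → Ends e b a
  Ends-sym (inj₁ p) = inj₂ p
  Ends-sym (inj₂ p) = inj₁ p

  Ends-incidentˡ : ∀ {e a b} → Ends e a b → Incident a e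
  Ends-incidentˡ (inj₁ (p , _)) = inj₁ (≡.sym p)
  Ends-incidentˡ (inj₂ (_ , p)) = inj₂ (≡.sym p)

  Ends-incidentʳ : ∀ {e a b} → Ends e a b → Incident b e
  Ends-incidentʳ = Ends-incidentˡ ∘ Ends-sym

  Ends-only : ∀ {e a b c} → Ends e a b → Incident c e → c ≡ a ⊎ c ≡ b
  Ends-only (inj₁ (p , q)) (inj₁ r) = inj₁ (ι-inj (≡.trans r p))
  Ends-only (inj₁ (p , q)) (inj₂ r) = inj₂ (ι-inj (≡.trans r q))
  Ends-only (inj₂ (p , q)) (inj₁ r) = inj₂ (ι-inj (≡.trans r p))
  Ends-only (inj₂ (p , q)) (inj₂ r) = inj₁ (ι-inj (≡.trans r q))

  Ends-other : ∀ {e a b c} → Ends e a b → Ends e a c → b ≡ c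
  Ends-other {e} (inj₁ (p , q)) (inj₁ (r , s)) = ι-inj (≡.trans (≡.sym q) s)
  Ends-other {e} (inj₁ (p , q)) (inj₂ (r , s)) = contradiction (≡.trans p (≡.sym s)) (source≢target e)
  Ends-other {e} (inj₂ (p , q)) (inj₁ (r , s)) = contradiction (≡.trans r (≡.sym q)) (source≢target e)
  Ends-other {e} (inj₂ (p , q)) (inj₂ (r , s)) = ι-inj (≡.trans (≡.sym p) r)

  Ends-irrefl : ∀ {e a b} → Ends e a b → a ≢ b
  Ends-irrefl {e} (inj₁ (p , q)) ≡.refl = source≢target e (≡.trans p (≡.sym q))
  Ends-irrefl {e} (inj₂ (p , q)) ≡.refl = source≢target e (≡.trans p (≡.sym q))

  -- Every edge is stored with its smaller end first, which rules out two entries with crossed ends;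
  -- otherwise the entries coincide in a duplicate-free list.
  Ends-unique : ∀ {e e' a b} → Ends e a b → Ends e' a b → e ≡ e'
  Ends-unique {e} {e'} p q = lookup-injective E₁-unique e e' (same p q)
    where
    pair : ∀ {e e'} → proj₁ (edge e) ≡ proj₁ (edge e') → proj₂ (edge e) ≡ proj₂ (edge e') → edge e ≡ edge e'
    pair p q = cong₂ _,_ p q
    crossed : ∀ {e e'} → proj₁ (edge e) ≡ proj₂ (edge e') → proj₂ (edge e) ≡ proj₁ (edge e') → edge e ≡ edge e'
    crossed {e} {e'} p q = contradiction (proj₂ (edge-proper e))
      (ℕₚ.<-asym (subst₂ (λ x y → toℕ x ℕ.< toℕ y) (≡.sym q) (≡.sym p) (proj₂ (edge-proper e'))))
    same : ∀ {e e' a b} → Ends e a b → Ends e' a b → edge e ≡ edge e'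
    same {e} {e'} (inj₁ (p , q)) (inj₁ (r , s)) = pair {e} {e'} (≡.trans p (≡.sym r)) (≡.trans q (≡.sym s))
    same {e} {e'} (inj₁ (p , q)) (inj₂ (r , s)) = crossed {e} {e'} (≡.trans p (≡.sym s)) (≡.trans q (≡.sym r))
    same {e} {e'} (inj₂ (p , q)) (inj₁ (r , s)) = crossed {e} {e'} (≡.trans p (≡.sym s)) (≡.trans q (≡.sym r))
    same {e} {e'} (inj₂ (p , q)) (inj₂ (r , s)) = pair {e} {e'} (≡.trans p (≡.sym r)) (≡.trans q (≡.sym s))

  Ends-adjacent : ∀ {e a b} → Ends e a b → kind G (ι a) (ι b) ≢ none
  Ends-adjacent {e} (inj₁ (p , q)) z = proj₁ (edge-proper e) (≡.trans (cong₂ (kind G) p q) z)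
  Ends-adjacent {e} {a} {b} (inj₂ (p , q)) z = proj₁ (edge-proper e)
    (≡.trans (cong₂ (kind G) p q) (≡.trans (symmetric G (ι a) (ι b)) (cong rev z)))

  label-incident : ∀ {c} (C : Components c) {a e} → Incident a e → Components.label C (inj₁ a) ≡ Components.label C (inj₂ e)
  label-incident C a-e = Components.complete C _ _ (a-e ◅ ε)

  δ-ι : ∀ a c → δ (ι a) (ι c) ≡ δ a c
  δ-ι a c with a Fin.≟ c
  ... | yes ≡.refl = δ-refl (ι a)
  ... | no p       = δ-≢ (p ∘ ι-inj)

  row-zero : ∀ {e c} → ¬ Incident c e → row e c ≡ 0ω
  row-zero {e} {c} p = ≡.trans (cong₂ (λ x y → x -ω nEntry (kind G (proj₂ (edge e)) (proj₁ (edge e))) *ω y)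
    (δ-≢ (p ∘ inj₁ ∘ ≡.sym)) (δ-≢ (p ∘ inj₂ ∘ ≡.sym))) (eq (nEntry (kind G (proj₂ (edge e)) (proj₁ (edge e)))))
    where
    eq : ∀ x → 0ω -ω x *ω 0ω ≡ 0ω
    eq = solve-∀ ℤω-acr

  row-unit : ∀ {e c} → Incident c e → Unit (row e c)
  row-unit {e} {c} (inj₁ p) = cong normω (≡.trans (cong₂ (λ x y → x -ω w *ω y)
    (≡.trans (cong (λ x → δ x (ι c)) (≡.sym p)) (δ-refl (ι c))) (δ-≢ (λ q → source≢target e (≡.trans (≡.sym p) (≡.sym q))))) (eq w))
    where
    w = nEntry (kind G (proj₂ (edge e)) (proj₁ (edge e)))
    eq : ∀ x → 1ω -ω x *ω 0ω ≡ 1ω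
    eq = solve-∀ ℤω-acr
  row-unit {e} {c} (inj₂ p) = ≡.trans (cong normω (≡.trans (cong₂ (λ x y → x -ω w *ω y)
    (δ-≢ (λ q → source≢target e (≡.trans q p))) (≡.trans (cong (λ x → δ x (ι c)) (≡.sym p)) (δ-refl (ι c)))) (eq w)))
    (unit-* (-ω 1ω) w ≡.refl (unit-nEntry (kind G (proj₂ (edge e)) (proj₁ (edge e)))
      (λ z → proj₁ (edge-proper e) (≡.trans (symmetric G _ _) (cong rev z)))))
    where
    w = nEntry (kind G (proj₂ (edge e)) (proj₁ (edge e)))
    eq : ∀ x → 0ω -ω x *ω 1ω ≡ (-ω 1ω) *ω x
    eq = solve-∀ ℤω-acr

  -- With this convention the row of an edge ab is, up to a unit, δ a - weight a b · δ b whichever way the edge is stored.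
  weight : Fin k → Fin k → ℤω
  weight a b = nEntry (kind G (ι b) (ι a))

  -- For an edge stored as ba the row is δ b - w̄ δ a; as w̄ times `weight a b` is 1, the unit -w̄
  -- can be factored out.
  row-Ends : ∀ {e a b} → Ends e a b → ∃[ u ] Unit u × ∀ c → row e c ≡ u *ω (δ a c -ω weight a b *ω δ b c)
  row-Ends {e} {a} {b} (inj₁ (p , q)) = 1ω , ≡.refl , λ c →
    ≡.trans (cong₂ (λ i j → δ i (ι c) -ω nEntry (kind G j i) *ω δ j (ι c)) p q)
    (≡.trans (cong₂ (λ x y → x -ω weight a b *ω y) (δ-ι a c) (δ-ι b c)) (≡.sym (*ω-identityˡ (δ a c -ω weight a b *ω δ b c))))
  row-Ends {e} {a} {b} E@(inj₂ (p , q)) = (-ω 1ω) *ω w̄ , unit-* (-ω 1ω) w̄ ≡.refl (unit-nEntry (kind G (ι a) (ι b)) (Ends-adjacent E)) , λ c →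
    ≡.trans (cong₂ (λ i j → δ i (ι c) -ω nEntry (kind G j i) *ω δ j (ι c)) p q)
    (≡.trans (cong₂ (λ x y → x -ω w̄ *ω y) (δ-ι b c) (δ-ι a c))
    (≡.trans (cong (_-ω w̄ *ω δ a c) (≡.sym (≡.trans (cong (_*ω δ b c) norm) (*ω-identityˡ (δ b c)))))
             (eq w̄ (weight a b) (δ b c) (δ a c))))
    where
    w̄ = nEntry (kind G (ι a) (ι b))
    norm : w̄ *ω weight a b ≡ 1ω
    norm = ≡.trans (cong (w̄ *ω_) (≡.trans (cong nEntry (symmetric G (ι a) (ι b))) (≡.sym (conj-nEntry (kind G (ι a) (ι b))))))
                   (unit-nEntry (kind G (ι a) (ι b)) (Ends-adjacent E))
    eq : ∀ n w x y → n *ω w *ω x -ω n *ω y ≡ (-ω 1ω) *ω n *ω (y -ω w *ω x)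
    eq = solve-∀ ℤω-acr

  turn : ∀ {c} (C : Components c) (j : Fin c) (Z : Component.Cycle C j) → Fin (suc (Component.Cycle.l Z)) → ℤ
  turn C j Z x = Component.stepTwist C j
    (kind G (ι (Component.Cycle.vert Z x)) (ι (Component.Cycle.vert Z (Component.next C j x))))

  -- The sum in the definition of twist is a local function of Defs, which cannot be named;
  -- unification in the with-abstracted equation below solves partialTwist to it.
  mutual
    partialTwist : ∀ {c} (C : Components c) (j : Fin c) (Z : Component.Cycle C j) (r : ℕ) → (Fin r → ℤ) → ℤ
    partialTwist C j Z r f = _

    twist≡partialTwist : ∀ {c} (C : Components c) (j : Fin c) (Z : Component.Cycle C j) →
      Component.twist C j Z ≡ turn C j Z zero ℤ.+ partialTwist C j Z (Component.Cycle.l Z) (λ i → turn C j Z (suc i))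
    twist≡partialTwist C j Z with Component.Cycle.l Z | (λ i → turn C j Z (suc i)) | turn C j Z zero
    ... | r | f | a = ≡.refl

  module CycleSequence {c : ℕ} (C : Components c) (j : Fin c) (Z : Component.Cycle C j) where
    open Component C j
    open Cycle Z

    -- The periodic extension of the cycle to ℕ, in the indexing of `CycleDet`; the return to the
    -- start becomes the equation `V-closed`.
    V : ℕ → Fin k
    V t = vert (t mod suc l)

    toℕ-mod : ∀ t → toℕ (t mod suc l) ≡ t % suc l
    toℕ-mod t = Finₚ.toℕ-fromℕ< _

    mod-cong : ∀ {s t} → s % suc l ≡ t % suc l → s mod suc l ≡ t mod suc l
    mod-cong {s} {t} p = Finₚ.toℕ-injective (≡.trans (toℕ-mod s) (≡.trans p (≡.sym (toℕ-mod t))))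

    mod-toℕ : ∀ (x : Fin (suc l)) → toℕ x mod suc l ≡ x
    mod-toℕ x = Finₚ.toℕ-injective (≡.trans (toℕ-mod (toℕ x)) (DM.m<n⇒m%n≡m (Finₚ.toℕ<n x)))

    next-mod : ∀ t → next (t mod suc l) ≡ suc t mod suc l
    next-mod t = mod-cong {suc (toℕ (t mod suc l))} {suc t} (≡.trans (cong (λ x → suc x % suc l) (toℕ-mod t))
      (≡.trans (DM.%-distribˡ-+ 1 (t % suc l) (suc l))
      (≡.trans (cong (λ x → (1 % suc l ℕ.+ x) % suc l) (DM.m%n%n≡m%n t (suc l)))
               (≡.sym (DM.%-distribˡ-+ 1 t (suc l))))))

    V-next : ∀ t → vert (next (t mod suc l)) ≡ V (suc t)
    V-next t = cong vert (next-mod t)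

    V-period : ∀ t → V (t ℕ.+ suc l) ≡ V t
    V-period t = cong vert (mod-cong {t ℕ.+ suc l} {t} (DM.[m+n]%n≡m%n t (suc l)))

    V-closed : V (suc l) ≡ V 0
    V-closed = V-period 0

    V-injective : ∀ {s t} → s ℕ.≤ l → t ℕ.≤ l → V s ≡ V t → s ≡ t
    V-injective {s} {t} p q e = ≡.trans (≡.sym (DM.m≤n⇒m%n≡m p)) (≡.trans (≡.sym (toℕ-mod s))
      (≡.trans (cong toℕ (inj _ _ e)) (≡.trans (toℕ-mod t) (DM.m≤n⇒m%n≡m q))))

    edgeAt : ℕ → Fin m
    edgeAt t = proj₁ (adj (t mod suc l))

    edgeAt-ends : ∀ t → Ends (edgeAt t) (V t) (V (suc t))
    edgeAt-ends t = subst (Ends (edgeAt t) (V t)) (V-next t) (proj₂ (proj₂ (adj (t mod suc l))))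

    w : ℕ → ℤω
    w t = weight (V t) (V (suc t))

    -- By the choice of `weight`, an edge directed along the traversal has weight ω̄; this is why
    -- `expω` takes powers of ω̄.
    expω-turn : ∀ x → expω (turn C j Z x) ≡ w (toℕ x)
    expω-turn x = ≡.trans (cong₂ (λ a b → expω (stepTwist (kind G (ι a) (ι b)))) (cong vert (≡.sym (mod-toℕ x)))
        (≡.trans (cong (vert ∘ next) (≡.sym (mod-toℕ x))) (V-next (toℕ x))))
      (≡.trans (go (kind G (ι (V t)) (ι (V (suc t)))) (Ends-adjacent (edgeAt-ends t)))
               (cong nEntry (≡.sym (symmetric G (ι (V t)) (ι (V (suc t)))))))
      where
      t = toℕ x
      go : ∀ κ → κ ≢ none → expω (stepTwist κ) ≡ nEntry (rev κ)
      go none  p = contradiction ≡.refl p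
      go undir p = ≡.refl
      go out   p = ≡.refl
      go inc   p = ≡.refl

    expω-twist : expω (twist Z) ≡ w l *ω productω (segment w 0 l)
    expω-twist = begin
      expω (twist Z)
        ≡⟨ cong expω (twist≡partialTwist C j Z) ⟩
      expω (turn C j Z zero ℤ.+ partialTwist C j Z l (turn C j Z ∘ suc))
        ≡⟨ expω-+ (turn C j Z zero) (partialTwist C j Z l (turn C j Z ∘ suc)) ⟩
      expω (turn C j Z zero) *ω expω (partialTwist C j Z l (turn C j Z ∘ suc))
        ≡⟨ cong (expω (turn C j Z zero) *ω_) (expω-partialTwist l (turn C j Z ∘ suc)) ⟩
      productω (tabulate (expω ∘ turn C j Z))
        ≡⟨ cong productω (tabulate-segment (suc l) (expω ∘ turn C j Z) w 0 expω-turn) ⟩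
      productω (segment w 0 (suc l))
        ≡⟨ cong productω (≡.trans (≡.sym (Listₚ.++-identityʳ (segment w 0 (suc l)))) (segment-snoc w 0 l [])) ⟩
      productω (segment w 0 l ++ w l ∷ [])
        ≡⟨ productω-snoc (segment w 0 l) (w l) ⟩
      w l *ω productω (segment w 0 l) ∎
      where
      open ≡-Reasoning
      expω-partialTwist : ∀ r (f : Fin r → ℤ) → expω (partialTwist C j Z r f) ≡ productω (tabulate (expω ∘ f))
      expω-partialTwist zero    f = ≡.refl
      expω-partialTwist (suc r) f = ≡.trans (expω-+ (f zero) (partialTwist C j Z r (f ∘ suc)))
        (cong (expω (f zero) *ω_) (expω-partialTwist r (f ∘ suc)))

    normω-monodromy : normω (1ω -ω w l *ω productω (segment w 0 l)) ≡ fromℕω (cycleWeight (residue Z))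
    normω-monodromy = ≡.trans (cong (λ x → normω (1ω -ω x)) (≡.trans (≡.sym expω-twist) (expω-%ℕ (twist Z))))
      (normω-cycleWeight (residue Z) (ℤDM.n%ℕd<d (twist Z) 6))

    -- Equal edges would have to be traversed in opposite directions, forcing t = s + 1 and V s = V
    -- (s + 2), which is impossible in a cycle of length at least 3.
    edgeAt-distinct : ∀ {s t} → s ℕ.< t → t ℕ.≤ l → edgeAt s ≢ edgeAt t
    edgeAt-distinct {s} {t} s<t t≤l p with subst (λ e → Ends e (V s) (V (suc s))) p (edgeAt-ends s)
    ... | E with Ends-only (edgeAt-ends t) (Ends-incidentˡ E)
    ...   | inj₁ q = ℕₚ.<⇒≢ s<t (V-injective (ℕₚ.<⇒≤ (ℕₚ.<-≤-trans s<t t≤l)) t≤l q)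
    ...   | inj₂ q with Ends-only (edgeAt-ends t) (Ends-incidentʳ E)
    ...     | inj₂ r = Ends-irrefl E (≡.trans q (≡.sym r))
    ...     | inj₁ r with V-injective (ℕₚ.≤-trans s<t t≤l) t≤l r
    ...       | ≡.refl with ℕₚ.m≤n⇒m<n∨m≡n t≤l
    ...         | inj₁ t<l = ℕₚ.<⇒≢ (ℕₚ.m<n⇒m<1+n (ℕₚ.n<1+n s)) (V-injective (ℕₚ.<⇒≤ (ℕₚ.<-≤-trans s<t t≤l)) t<l q)
    ...         | inj₂ ≡.refl with V-injective {s} {0} (ℕₚ.n≤1+n s) ℕ.z≤n (≡.trans q V-closed)
    ...           | ≡.refl = contradiction long λ { (ℕ.s≤s ()) }

-- Growing a closed set of matched vertices and edges

fromℕω-* : ∀ a b → fromℕω (a ℕ.* b) ≡ fromℕω a *ω fromℕω b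
fromℕω-* a b = cong₂ _+_ω (≡.trans (ℤₚ.pos-* a b) (≡.sym (ℤₚ.+-identityʳ (+ a ℤ.* + b))))
  (≡.sym (cong (λ x → x ℤ.+ + 0 ℤ.+ + 0) (ℤₚ.*-zeroʳ (+ a))))

↭-allFin : ∀ {m} {xs : List (Fin m)} → Unique xs → (∀ x → x ∈ xs) → xs ↭ allFin m
↭-allFin {m} xs! all = ∼bag⇒↭ (unique∧set⇒bag xs! (Uniqueₚ.allFin⁺ m) (mk⇔ (λ _ → ∈ₚ.∈-allFin _) (λ _ → all _)))

unique⇒complete : ∀ {m} {xs : List (Fin m)} → Unique xs → length xs ≡ m → ∀ x → x ∈ xs
unique⇒complete {m} {xs} xs! len x with DecMembership._∈?_ Fin._≟_ x xs
... | yes p = p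
... | no p  = contradiction (ℕₚ.≤-trans (ℕₚ.≤-reflexive (cong suc (≡.sym len)))
    (Finₚ.injective⇒≤ {f = List.lookup (x ∷ xs)} (lookup-injective (Allₚ.¬Any⇒All¬ xs p ∷ xs!) _ _))) ℕₚ.1+n≰n

module ComponentExpansion {n k : ℕ} (G : MixedGraph n) (ι : Fin k → Fin n) (ι-inj : Injective _≡_ _≡_ ι)
           (E₁ : List (Edge n)) (E₁-proper : All (Proper G) E₁) (E₁-unique : Unique E₁) where
  open Substructure G ι E₁
  open IncidenceStructure G ι ι-inj E₁ E₁-proper E₁-unique
  open DecMembership (Fin._≟_ {k}) using (_∈?_)

  -- The rows and columns of a submatrix, with as many edges as vertices.
  Pairs : Set
  Pairs = List (Fin k × Fin m)

  vs : Pairs → List (Fin k)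
  vs = map proj₁

  es : Pairs → List (Fin m)
  es = map proj₂

  value : Pairs → ℤω
  value ps = normω (Det (map row (es ps)) (vs ps))

  -- `closed` says that the chosen rows vanish outside the chosen columns, which is the zero block
  -- of the triangular shape.
  record Closed (ps : Pairs) : Set where
    field
      closed    : ∀ {e a} → e ∈ es ps → Incident a e → a ∈ vs ps
      vs-unique : Unique (vs ps)
      es-unique : Unique (es ps)
  open Closed

  rows-zero : ∀ {ps} → Closed ps → ∀ {b} → b ∉ vs ps → All (λ r → r b ≡ 0ω) (map row (es ps))
  rows-zero cl b∉ = Allₚ.map⁺ (All.tabulate λ e∈ → row-zero λ c-e → b∉ (closed cl e∈ c-e))

  -- The column of `b` vanishes in all old rows, so the new determinant is a unit pivot times the
  -- old one. Closure also shows that `e` is new, since otherwise `b` would be present.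
  grow : ∀ {ps b e} → Closed ps → b ∉ vs ps → Incident b e → (∀ {c} → Incident c e → c ≡ b ⊎ c ∈ vs ps) →
         Closed ((b , e) ∷ ps) × value ((b , e) ∷ ps) ≡ value ps
  grow {ps} {b} {e} cl b∉ b-e only = record
    { closed    = λ { (here ≡.refl) c-e → extend (only c-e) ; (there e∈) c-e → there (closed cl e∈ c-e) }
    ; vs-unique = Allₚ.¬Any⇒All¬ (vs ps) b∉ ∷ vs-unique cl
    ; es-unique = Allₚ.¬Any⇒All¬ (es ps) (λ e∈ → b∉ (closed cl e∈ b-e)) ∷ es-unique cl
    } , unit-absorb (row e b) (Det (map row (es ps)) (vs ps)) (row-unit b-e)
          (Det-pivot (row e) (map row (es ps)) b (vs ps) (rows-zero cl b∉))
    where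
    extend : ∀ {c} → c ≡ b ⊎ c ∈ vs ps → c ∈ b ∷ vs ps
    extend (inj₁ p) = here p
    extend (inj₂ p) = there p

  Extends : Pairs → Pairs → Set
  Extends ps ps' = Closed ps' × (∀ {a} → a ∈ vs ps → a ∈ vs ps')

  join : ∀ {a b} e → Ends e a b → ∀ {ps} → Closed ps → b ∈ vs ps →
         ∃[ ps' ] Extends ps ps' × value ps' ≡ value ps × a ∈ vs ps'
  join {a} {b} e ends {ps} cl b∈ = decide (a ∈? vs ps)
    where
    only : ∀ {c} → c ≡ a ⊎ c ≡ b → c ≡ a ⊎ c ∈ vs ps
    only (inj₁ p)      = inj₁ p
    only (inj₂ ≡.refl) = inj₂ b∈
    decide : Dec (a ∈ vs ps) → ∃[ ps' ] Extends ps ps' × value ps' ≡ value ps × a ∈ vs ps'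
    decide (yes a∈) = ps , (cl , id) , ≡.refl , a∈
    decide (no a∉)  =
      let cl' , val = grow cl a∉ (Ends-incidentˡ {e} {a} {b} ends) (only ∘ Ends-only {e} {a} {b} ends)
      in (a , e) ∷ ps , (cl' , there) , val , here ≡.refl

  module _ {c : ℕ} (C : Components c) where
    open Components C

    -- The path is worked off from its far end `r`, so that each edge is added when one of its ends
    -- is already present.
    reach : ∀ j {a r ps} → Star (Component.FullAdj C j) a r → Closed ps → r ∈ vs ps →
            ∃[ ps' ] Extends ps ps' × value ps' ≡ value ps × a ∈ vs ps'
    reach j ε cl r∈ = _ , (cl , id) , ≡.refl , r∈
    reach j ((e , _ , ends) ◅ path) cl r∈ =
      let ps' , (cl' , sub) , val , b∈ = reach j path cl r∈
          ps'' , (cl'' , sub') , val' , a∈ = join e ends cl' b∈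
      in ps'' , (cl'' , sub' ∘ sub) , ≡.trans val' val , a∈

    -- A start for component `j`, contributing the factor `x` to any closed set that avoids `j`. The
    -- last conjunct confines the new vertices to `j`, so the starts of the other components remain
    -- applicable.
    Core : Fin c → ℕ → Set
    Core j x = ∀ {ps} → Closed ps → (∀ {a} → a ∈ vs ps → label (inj₁ a) ≢ j) →
      ∃[ ps' ] Extends ps ps' × value ps' ≡ fromℕω x *ω value ps
        × (∃[ a ] a ∈ vs ps' × label (inj₁ a) ≡ j) × (∀ {a} → a ∈ vs ps' → label (inj₁ a) ≡ j ⊎ a ∈ vs ps)

    -- A half edge has one end in V₁, so its row has a single nonzero entry, a unit.
    core-halfEdge : ∀ j e → Component.EIn C j e → Half e → Core j 1
    core-halfEdge j e e-in half {ps} cl avoid = rooted (root half)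
      where
      root : Half e → ∃[ a ] Incident a e × (∀ {c} → Incident c e → c ≡ a)
      root (inj₁ ((a , p) , q)) = a , inj₁ p , λ { (inj₁ r) → ι-inj (≡.trans r (≡.sym p)) ; (inj₂ r) → contradiction (_ , r) q }
      root (inj₂ (q , (a , p))) = a , inj₂ p , λ { (inj₂ r) → ι-inj (≡.trans r (≡.sym p)) ; (inj₁ r) → contradiction (_ , r) q }
      rooted : ∃[ a ] Incident a e × (∀ {c} → Incident c e → c ≡ a) →
        ∃[ ps' ] Extends ps ps' × value ps' ≡ fromℕω 1 *ω value ps
          × (∃[ a ] a ∈ vs ps' × label (inj₁ a) ≡ j) × (∀ {a} → a ∈ vs ps' → label (inj₁ a) ≡ j ⊎ a ∈ vs ps)
      rooted (a , a-e , only) =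
        let a-in = ≡.trans (label-incident C a-e) e-in
            cl' , val = grow cl (λ a∈ → avoid a∈ a-in) a-e (inj₁ ∘ only)
        in (a , e) ∷ ps , (cl' , there) , ≡.trans val (≡.sym (*ω-identityˡ (value ps))) , (a , here ≡.refl , a-in)
           , λ { (here ≡.refl) → inj₁ a-in ; (there p) → inj₂ p }

    -- The edges of the cycle have both ends on it and its columns vanish in the old rows, so the
    -- block evaluated by `CycleDet` splits off.
    core-cycle : ∀ j (Z : Component.Cycle C j) → Core j (cycleWeight (Component.residue C j Z))
    core-cycle j Z {ps} cl avoid = ps' , (record { closed = closed' ; vs-unique = vs'! ; es-unique = es'! } , λ {a} a∈ → subst (a ∈_) (≡.sym vs-eq) (∈ₚ.∈-++⁺ʳ (segment V 0 (suc l)) a∈))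
      , value' , (V 0 , V∈ ℕ.z≤n , V-in 0) , origin
      where
      open Component C j
      open Cycle Z using (l; inComp)
      open CycleSequence C j Z
      pr : ℕ → Fin k × Fin m
      pr t = V t , edgeAt t
      ps' : Pairs
      ps' = segment pr 0 (suc l) ++ ps
      V-in : ∀ t → label (inj₁ (V t)) ≡ j
      V-in t = inComp _
      V∉ : ∀ t → V t ∉ vs ps
      V∉ t p = avoid p (V-in t)
      vs-eq : vs ps' ≡ segment V 0 (suc l) ++ vs ps
      vs-eq = ≡.trans (Listₚ.map-++ proj₁ (segment pr 0 (suc l)) ps) (cong (_++ vs ps) (map-segment proj₁ pr 0 (suc l)))
      es-eq : es ps' ≡ segment edgeAt 0 (suc l) ++ es ps
      es-eq = ≡.trans (Listₚ.map-++ proj₂ (segment pr 0 (suc l)) ps) (cong (_++ es ps) (map-segment proj₂ pr 0 (suc l)))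
      V∈ : ∀ {t} → t ℕ.≤ l → V t ∈ vs ps'
      V∈ {t} t≤l = subst (V t ∈_) (≡.sym vs-eq) (∈ₚ.∈-++⁺ˡ (∈-segment⁺ V (suc l) (ℕ.s≤s t≤l)))
      V-suc∈ : ∀ {t} → t ℕ.≤ l → V (suc t) ∈ vs ps'
      V-suc∈ t≤l with ℕₚ.m≤n⇒m<n∨m≡n t≤l
      ... | inj₁ t<l    = V∈ t<l
      ... | inj₂ ≡.refl = subst (_∈ vs ps') (≡.sym V-closed) (V∈ ℕ.z≤n)
      closed' : ∀ {e a} → e ∈ es ps' → Incident a e → a ∈ vs ps'
      closed' {e} {a} e∈ c-e with ∈ₚ.∈-++⁻ (segment edgeAt 0 (suc l)) (subst (e ∈_) es-eq e∈)
      ... | inj₂ p = subst (a ∈_) (≡.sym vs-eq) (∈ₚ.∈-++⁺ʳ (segment V 0 (suc l)) (closed cl p c-e))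
      ... | inj₁ p with ∈-segment⁻ edgeAt (suc l) p
      ...   | t , ℕ.s≤s t≤l , ≡.refl with Ends-only (edgeAt-ends t) c-e
      ...     | inj₁ ≡.refl = V∈ t≤l
      ...     | inj₂ ≡.refl = V-suc∈ t≤l
      V-distinct : ∀ {s t} → s ℕ.< t → t ℕ.≤ l → V s ≢ V t
      V-distinct s<t t≤l p = ℕₚ.<⇒≢ s<t (V-injective (ℕₚ.<⇒≤ (ℕₚ.<-≤-trans s<t t≤l)) t≤l p)
      vs'! : Unique (vs ps')
      vs'! = subst Unique (≡.sym vs-eq) (Uniqueₚ.++⁺ (segment-Unique V 0 (suc l) (λ { i<j (ℕ.s≤s j≤l) → V-distinct i<j j≤l })) (vs-unique cl) disjoint)
        where
        disjoint : ∀ {a} → ¬ (a ∈ segment V 0 (suc l) × a ∈ vs ps)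
        disjoint (p , q) with ∈-segment⁻ V (suc l) p
        ... | t , _ , ≡.refl = V∉ t q
      es'! : Unique (es ps')
      es'! = subst Unique (≡.sym es-eq) (Uniqueₚ.++⁺ (segment-Unique edgeAt 0 (suc l) (λ { i<j (ℕ.s≤s j≤l) → edgeAt-distinct i<j j≤l })) (es-unique cl) disjoint)
        where
        disjoint : ∀ {e} → ¬ (e ∈ segment edgeAt 0 (suc l) × e ∈ es ps)
        disjoint (p , q) with ∈-segment⁻ edgeAt (suc l) p
        ... | t , _ , ≡.refl = V∉ t (closed cl q (Ends-incidentˡ (edgeAt-ends t)))
      origin : ∀ {a} → a ∈ vs ps' → label (inj₁ a) ≡ j ⊎ a ∈ vs ps
      origin {a} a∈ with ∈ₚ.∈-++⁻ (segment V 0 (suc l)) (subst (a ∈_) vs-eq a∈)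
      ... | inj₂ p = inj₂ p
      ... | inj₁ p with ∈-segment⁻ V (suc l) p
      ...   | t , _ , ≡.refl = inj₁ (V-in t)
      -- Row `l` is separated from the segment because the reduction in `CycleDet` treats it as the
      -- last row.
      rows-eq : map row (es ps') ≡ segment (row ∘ edgeAt) 0 l ++ row (edgeAt l) ∷ map row (es ps)
      rows-eq = ≡.trans (cong (map row) es-eq) (≡.trans (Listₚ.map-++ row (segment edgeAt 0 (suc l)) (es ps))
        (≡.trans (cong (_++ map row (es ps)) (map-segment row edgeAt 0 (suc l))) (segment-snoc (row ∘ edgeAt) 0 l (map row (es ps)))))
      module CD = CycleDet l V (λ t → proj₁ (row-Ends (edgeAt-ends t))) w (row ∘ edgeAt)
        (λ t → proj₁ (proj₂ (row-Ends (edgeAt-ends t)))) (λ t → proj₂ (proj₂ (row-Ends (edgeAt-ends t))))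
        V-distinct (map row (es ps)) (vs ps) (λ t _ → rows-zero cl (V∉ t))
      value' : value ps' ≡ fromℕω (cycleWeight (residue Z)) *ω value ps
      value' = ≡.trans (cong₂ (λ rs cs → normω (Det rs cs)) rows-eq (≡.trans vs-eq (segment-snoc V 0 l (vs ps))))
        (≡.trans (CD.normω-Det-cycle V-closed) (cong (_*ω value ps) normω-monodromy))

    module _ (x : Fin c → ℕ) (x-core : ∀ j → Core j (x j)) (connected : ∀ j → Component.FullConnected C j) where

      cores : ∀ {js} → Unique js → ∃[ ps ] Closed ps × value ps ≡ fromℕω (product (map x js))
        × (∀ {j} → j ∈ js → ∃[ a ] a ∈ vs ps × label (inj₁ a) ≡ j) × (∀ {a} → a ∈ vs ps → label (inj₁ a) ∈ js)
      cores [] = [] , record { closed = λ () ; vs-unique = [] ; es-unique = [] } , ≡.refl , (λ ()) , λ ()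
      cores {j ∷ js} (j∉ ∷ js!) =
        let ps , cl , val , roots , labels = cores js!
            ps' , (cl' , sub) , val' , root , origin = x-core j cl (λ a∈ p → All.lookup j∉ (labels a∈) (≡.sym p))
        in ps' , cl' , ≡.trans val' (≡.trans (cong (fromℕω (x j) *ω_) val) (≡.sym (fromℕω-* (x j) (product (map x js)))))
        , (λ { (here ≡.refl) → root ; (there i∈) → let a , a∈ , p = roots i∈ in a , sub a∈ , p })
        , (λ a∈ → Sum.[ here , there ∘ labels ]′ (origin a∈))

      -- Every remaining vertex has a path of full edges to the start of its component, and
      -- attaching it costs only unit factors.
      saturate : ∀ {ps} → Closed ps → (∀ j → ∃[ a ] a ∈ vs ps × label (inj₁ a) ≡ j) → ∀ as →
                 ∃[ ps' ] Extends ps ps' × value ps' ≡ value ps × All (_∈ vs ps') as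
      saturate {ps} cl roots [] = ps , (cl , id) , ≡.refl , []
      saturate {ps} cl roots (a ∷ as) =
        let ps' , (cl' , sub) , val , as∈ = saturate cl roots as
            r , r∈ , p = roots (label (inj₁ a))
            ps'' , (cl'' , sub') , val' , a∈ = reach (label (inj₁ a)) (connected (label (inj₁ a)) a r ≡.refl p) cl' (sub r∈)
        in ps'' , (cl'' , sub' ∘ sub) , ≡.trans val' val , a∈ ∷ All.map sub' as∈

      -- Once all vertices are present there are `k` distinct edges in the pairs, and m ≡ k makes
      -- them all of E₁.
      normω-Det-components : m ≡ k → normω (Det (map row (allFin m)) (allFin k)) ≡ fromℕω (product (map x (allFin c)))
      normω-Det-components m≡k =
        let ps , cl , val , roots , _ = cores (Uniqueₚ.allFin⁺ c)
            ps' , (cl' , _) , val' , all∈ = saturate cl (λ j → roots (∈ₚ.∈-allFin j)) (allFin k)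
        in ≡.trans (spanning-value cl' λ a → All.lookup all∈ (∈ₚ.∈-allFin a)) (≡.trans val' val)
        where
        spanning-value : ∀ {ps} → Closed ps → (∀ a → a ∈ vs ps) → normω (Det (map row (allFin m)) (allFin k)) ≡ value ps
        spanning-value {ps} cl all = ≡.sym (normω-Det-↭ (↭ₚ.map⁺ row es↭) vs↭)
          where
          vs↭ : vs ps ↭ allFin k
          vs↭ = ↭-allFin (vs-unique cl) all
          es-length : length (es ps) ≡ m
          es-length = ≡.trans (Listₚ.length-map proj₂ ps) (≡.trans (≡.sym (Listₚ.length-map proj₁ ps))
            (≡.trans (↭ₚ.↭-length vs↭) (≡.trans (Listₚ.length-tabulate id) (≡.sym m≡k))))
          es↭ : es ps ↭ allFin m
          es↭ = ↭-allFin (es-unique cl) (unique⇒complete (es-unique cl) es-length)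

  -- Values of substructures of type I

  kindWeight : CompKind → ℕ
  kindWeight rootlessTree = 1
  kindWeight uniΦ₁        = 1
  kindWeight uniΦ₂        = 3
  kindWeight uniΦ₃        = 4

  core-kind : ∀ {c} (C : Components c) j κ → HasKind C j κ → Core C j (kindWeight κ)
  core-kind C j rootlessTree (_ , _ , _ , e , e-in , half , _) = core-halfEdge C j e e-in half
  core-kind C j uniΦ₁ (_ , _ , _ , Z , φ , _) = subst (Core C j) (Sum.[ cong cycleWeight , cong cycleWeight ]′ φ) (core-cycle C j Z)
  core-kind C j uniΦ₂ (_ , _ , _ , Z , φ , _) = subst (Core C j) (Sum.[ cong cycleWeight , cong cycleWeight ]′ φ) (core-cycle C j Z)
  core-kind C j uniΦ₃ (_ , _ , _ , Z , φ , _) = subst (Core C j) (cong cycleWeight φ) (core-cycle C j Z)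

  kind-connected : ∀ {c} (C : Components c) j κ → HasKind C j κ → Component.FullConnected C j
  kind-connected C j rootlessTree (_ , conn , _)     = conn
  kind-connected C j uniΦ₁        (_ , _ , conn , _) = conn
  kind-connected C j uniΦ₂        (_ , _ , conn , _) = conn
  kind-connected C j uniΦ₃        (_ , _ , conn , _) = conn

  product-kindWeight : ∀ {c} (κ : Fin c → CompKind) js → product (map (kindWeight ∘ κ) js)
    ≡ 3 ℕ.^ sum (map (λ j → if isΦ₂ (κ j) then 1 else 0) js) ℕ.* 4 ℕ.^ sum (map (λ j → if isΦ₃ (κ j) then 1 else 0) js)
  product-kindWeight κ []       = ≡.refl
  product-kindWeight κ (j ∷ js) = ≡.trans (cong (kindWeight (κ j) ℕ.*_) (product-kindWeight κ js)) (weigh (κ j) _ _)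
    where
    exchange : ∀ x y → 4 ℕ.* (x ℕ.* y) ≡ x ℕ.* (4 ℕ.* y)
    exchange = ℕ-solve-∀
    weigh : ∀ κ p q → kindWeight κ ℕ.* (3 ℕ.^ p ℕ.* 4 ℕ.^ q)
      ≡ 3 ℕ.^ ((if isΦ₂ κ then 1 else 0) ℕ.+ p) ℕ.* 4 ℕ.^ ((if isΦ₃ κ then 1 else 0) ℕ.+ q)
    weigh rootlessTree p q = ℕₚ.*-identityˡ _
    weigh uniΦ₁        p q = ℕₚ.*-identityˡ _
    weigh uniΦ₂        p q = ≡.sym (ℕₚ.*-assoc 3 (3 ℕ.^ p) (4 ℕ.^ q))
    weigh uniΦ₃        p q = exchange (3 ℕ.^ p) (4 ℕ.^ q)

  typeI-value : m ≡ k → ∀ {γ₁ γ₂} → TypeIWith γ₁ γ₂ →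
                normω (Det (map row (allFin m)) (allFin k)) ≡ fromℕω (3 ℕ.^ γ₁ ℕ.* 4 ℕ.^ γ₂)
  typeI-value m≡k (c , C , κ , κ-kind , ≡.refl , ≡.refl) = ≡.trans
    (normω-Det-components C (kindWeight ∘ κ) (λ j → core-kind C j (κ j) (κ-kind j)) (λ j → kind-connected C j (κ j) (κ-kind j)) m≡k)
    (cong fromℕω (product-kindWeight κ (allFin c)))

-- Functional graphs from matchings

-- Lets reachability between all pairs of nodes be treated as decided while a contradiction is being
-- derived.
¬¬-∀Fin : ∀ n {P : Fin n → Set} → (∀ i → ¬ ¬ P i) → ¬ ¬ (∀ i → P i)
¬¬-∀Fin zero    p k = k λ ()
¬¬-∀Fin (suc n) p k = p zero λ p₀ → ¬¬-∀Fin n (p ∘ suc) λ ps → k λ { zero → p₀ ; (suc i) → ps i }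

least : {P : ℕ → Set} → (∀ n → Dec (P n)) → ∀ n → P n → ∃[ l ] P l × (∀ {i} → i ℕ.< l → ¬ P i)
least {P} P? n pn = go n 0 (λ ()) (subst P (≡.sym (ℕₚ.+-identityʳ n)) pn)
  where
  go : ∀ fuel l → (∀ {i} → i ℕ.< l → ¬ P i) → P (fuel ℕ.+ l) → ∃[ l ] P l × (∀ {i} → i ℕ.< l → ¬ P i)
  go zero       l below p = l , p , below
  go (suc fuel) l below p with P? l
  ... | yes q = l , q , below
  ... | no ¬q = go fuel (suc l) below' (subst P (≡.sym (ℕₚ.+-suc fuel l)) p)
    where
    below' : ∀ {i} → i ℕ.< suc l → ¬ P i
    below' (ℕ.s≤s i≤l) with ℕₚ.m≤n⇒m<n∨m≡n i≤l
    ... | inj₁ i<l    = below i<l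
    ... | inj₂ ≡.refl = ¬q

record Classes (N : ℕ) (R : Fin N → Fin N → Set) : Set where
  field
    size     : ℕ
    class    : Fin N → Fin size
    class-surjective : ∀ j → ∃[ x ] class x ≡ j
    class-sound      : ∀ x y → class x ≡ class y → R x y
    class-complete   : ∀ x y → R x y → class x ≡ class y

-- The first element either joins the class of a later element related to it or forms a class of its
-- own.
classes : ∀ N (R : Fin N → Fin N → Set) → (∀ x y → Dec (R x y)) → (∀ x → R x x) → (∀ {x y} → R x y → R y x) →
          (∀ {x y z} → R x y → R y z → R x z) → Classes N R
classes zero    R R? refl' sym' trans' = record
  { size = 0 ; class = λ () ; class-surjective = λ () ; class-sound = λ () ; class-complete = λ () }
classes (suc N) R R? refl' sym' trans' = extend (Finₚ.any? (λ i → R? zero (suc i)))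
  where
  K : Classes N (λ x y → R (suc x) (suc y))
  K = classes N (λ x y → R (suc x) (suc y)) (λ x y → R? (suc x) (suc y)) (λ x → refl' (suc x)) sym' trans'
  open Classes K
  extend : Dec (∃[ i ] R zero (suc i)) → Classes (suc N) R
  extend (yes (i , r)) = record
    { size = size
    ; class = λ { zero → class i ; (suc x) → class x }
    ; class-surjective = λ j → let x , p = class-surjective j in suc x , p
    ; class-sound = λ
        { zero zero p → refl' zero
        ; zero (suc y) p → trans' r (class-sound i y p)
        ; (suc x) zero p → sym' (trans' r (class-sound i x (≡.sym p)))
        ; (suc x) (suc y) p → class-sound x y p }
    ; class-complete = λ
        { zero zero p → ≡.refl
        ; zero (suc y) p → class-complete i y (trans' (sym' r) p)
        ; (suc x) zero p → ≡.sym (class-complete i x (trans' (sym' r) (sym' p)))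
        ; (suc x) (suc y) p → class-complete x y p } }
  extend (no ¬r) = record
    { size = suc size
    ; class = λ { zero → zero ; (suc x) → suc (class x) }
    ; class-surjective = λ { zero → zero , ≡.refl ; (suc j) → let x , p = class-surjective j in suc x , cong suc p }
    ; class-sound = λ
        { zero zero p → refl' zero
        ; zero (suc y) ()
        ; (suc x) zero ()
        ; (suc x) (suc y) p → class-sound x y (Finₚ.suc-injective p) }
    ; class-complete = λ
        { zero zero p → ≡.refl
        ; zero (suc y) p → contradiction (y , p) ¬r
        ; (suc x) zero p → contradiction (x , sym' p) ¬r
        ; (suc x) (suc y) p → cong suc (class-complete x y p) } }

module MatchingOrientation {n k : ℕ} (G : MixedGraph n) (ι : Fin k → Fin n) (ι-inj : Injective _≡_ _≡_ ι)
           (E₁ : List (Edge n)) (E₁-proper : All (Proper G) E₁) (E₁-unique : Unique E₁) where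
  open Substructure G ι E₁
  open IncidenceStructure G ι ι-inj E₁ E₁-proper E₁-unique

  Link-sym : ∀ {x y} → Link x y → Link y x
  Link-sym {inj₁ a} {inj₂ e} l = l
  Link-sym {inj₂ e} {inj₁ a} l = l

  -- A numbering of the components requires deciding `Star Link`, and this is available only under a
  -- double negation. The nodes are numbered through `splitAt` to apply `classes`.
  components : ¬ ¬ (∃[ c ] Components c)
  components no-components =
    ¬¬-∀Fin (k ℕ.+ m) (λ x → ¬¬-∀Fin (k ℕ.+ m) (λ y → ¬¬-excluded-middle {A = Star Link (splitAt k x) (splitAt k y)}))
      λ R? → no-components (_ , build (classes (k ℕ.+ m) _ R? (λ _ → ε) (Star.reverse Link-sym) _◅◅_))
    where
    build : (K : Classes (k ℕ.+ m) (λ x y → Star Link (splitAt k x) (splitAt k y))) → Components (Classes.size K)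
    build K = record
      { label    = class ∘ Fin.join k m
      ; surj     = λ j → let x , p = class-surjective j in splitAt k x , ≡.trans (cong class (Finₚ.join-splitAt k m x)) p
      ; sound    = λ x y p → subst₂ (Star Link) (Finₚ.splitAt-join k m x) (Finₚ.splitAt-join k m y) (class-sound _ _ p)
      ; complete = λ x y p → class-complete _ _ (subst₂ (Star Link) (≡.sym (Finₚ.splitAt-join k m x)) (≡.sym (Finₚ.splitAt-join k m y)) p)
      }
      where open Classes K

  InV₁? : ∀ u → Dec (InV₁ u)
  InV₁? u = Finₚ.any? (λ a → ι a Fin.≟ u)

  Half? : ∀ e → Dec (Half e)
  Half? e = (InV₁? _ ×-dec ¬? (InV₁? _)) ⊎-dec (¬? (InV₁? _) ×-dec InV₁? _)

  Ends⇒Full : ∀ {e a b} → Ends e a b → Full e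
  Ends⇒Full (inj₁ (p , q)) = (_ , ≡.sym p) , (_ , ≡.sym q)
  Ends⇒Full (inj₂ (p , q)) = (_ , ≡.sym p) , (_ , ≡.sym q)

  Full⇒¬Half : ∀ {e} → Full e → ¬ Half e
  Full⇒¬Half (p , q) (inj₁ (_ , r)) = r q
  Full⇒¬Half (p , q) (inj₂ (r , _)) = r p

  Half-only : ∀ {e a b} → Half e → Incident a e → Incident b e → a ≡ b
  Half-only (inj₁ (_ , p)) (inj₁ q) (inj₁ r) = ι-inj (≡.trans q (≡.sym r))
  Half-only (inj₁ (_ , p)) (inj₂ q) _        = contradiction (_ , q) p
  Half-only (inj₁ (_ , p)) _        (inj₂ r) = contradiction (_ , r) p
  Half-only (inj₂ (p , _)) (inj₂ q) (inj₂ r) = ι-inj (≡.trans q (≡.sym r))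
  Half-only (inj₂ (p , _)) (inj₁ q) _        = contradiction (_ , q) p
  Half-only (inj₂ (p , _)) _        (inj₁ r) = contradiction (_ , r) p

  module Matching (τ : Fin m → Fin k) (σ : Fin k → Fin m) (τσ : ∀ a → τ (σ a) ≡ a) (στ : ∀ e → σ (τ e) ≡ e)
                  (τ-incident : ∀ e → Incident (τ e) e) where

    Shape : Fin m → Set
    Shape e = (∃[ b ] Ends e (τ e) b) ⊎ Half e

    shape : ∀ e → Shape e
    shape e with τ-incident e
    ... | inj₁ p with InV₁? (proj₂ (edge e))
    ...   | yes (b , q) = inj₁ (b , inj₁ (≡.sym p , ≡.sym q))
    ...   | no ¬q       = inj₂ (inj₁ ((_ , p) , ¬q))
    shape e | inj₂ p with InV₁? (proj₁ (edge e))
    ...   | yes (b , q) = inj₁ (b , inj₂ (≡.sym q , ≡.sym p))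
    ...   | no ¬q       = inj₂ (inj₂ (¬q , (_ , p)))

    other : ∀ {e} → Shape e → Fin k
    other {e} (inj₁ (b , _)) = b
    other {e} (inj₂ _)       = τ e

    -- orients every edge away from the vertex it is matched with; half edges become loops
    f : Fin k → Fin k
    f a = other (shape (σ a))

    f-step : ∀ a → Ends (σ a) a (f a) ⊎ (Half (σ a) × f a ≡ a)
    f-step a = go (shape (σ a))
      where
      go : (s : Shape (σ a)) → Ends (σ a) a (other s) ⊎ (Half (σ a) × other s ≡ a)
      go (inj₁ (b , ends)) = inj₁ (subst (λ x → Ends (σ a) x b) (τσ a) ends)
      go (inj₂ half)       = inj₂ (half , τσ a)

    f-ends : ∀ {e a b} → Ends e a b → τ e ≡ a → σ a ≡ e × f a ≡ b
    f-ends {e} {a} {b} ends ≡.refl = στ e , go (f-step (τ e))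
      where
      go : Ends (σ (τ e)) (τ e) (f (τ e)) ⊎ (Half (σ (τ e)) × f (τ e) ≡ τ e) → f (τ e) ≡ b
      go (inj₁ ends')      = Ends-other {e} (subst (λ x → Ends x (τ e) (f (τ e))) (στ e) ends') ends
      go (inj₂ (half , _)) = contradiction (subst Half (στ e) half) (Full⇒¬Half (Ends⇒Full ends))

    -- Every full edge is an arc of the functional graph, leaving the end it is matched with.
    f-oriented : ∀ {e a b} → Ends e a b → (σ a ≡ e × f a ≡ b) ⊎ (σ b ≡ e × f b ≡ a)
    f-oriented {e} ends = Sum.map (f-ends ends) (f-ends (Ends-sym {e} ends)) (Ends-only ends (τ-incident e))

    f-half : ∀ {e} → Half e → f (τ e) ≡ τ e
    f-half {e} half = go (f-step (τ e))
      where
      go : Ends (σ (τ e)) (τ e) (f (τ e)) ⊎ (Half (σ (τ e)) × f (τ e) ≡ τ e) → f (τ e) ≡ τ e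
      go (inj₁ ends)    = contradiction (subst Half (≡.sym (στ e)) half) (Full⇒¬Half (Ends⇒Full ends))
      go (inj₂ (_ , p)) = p

    it : ℕ → Fin k → Fin k
    it zero    a = a
    it (suc i) a = f (it i a)

    it-+ : ∀ i j a → it (i ℕ.+ j) a ≡ it i (it j a)
    it-+ zero    j a = ≡.refl
    it-+ (suc i) j a = cong f (it-+ i j a)

    it-fixed : ∀ {a} → f a ≡ a → ∀ i → it i a ≡ a
    it-fixed p zero    = ≡.refl
    it-fixed p (suc i) = ≡.trans (cong f (it-fixed p i)) p

    it-multiple : ∀ {a} q → it q a ≡ a → ∀ i → it (i ℕ.* q) a ≡ a
    it-multiple q p zero    = ≡.refl
    it-multiple {a} q p (suc i) = ≡.trans (it-+ q (i ℕ.* q) a) (≡.trans (cong (it q) (it-multiple q p i)) p)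

    -- Forward orbits that eventually coincide: in a functional graph this characterises lying in
    -- the same connected component.
    Meets : Fin k → Fin k → Set
    Meets a b = ∃[ i ] ∃[ j ] it i a ≡ it j b

    -- Iterates of `f` commute, so the two meeting points can be pushed forward to a common one.
    Meets-trans : ∀ {a b c} → Meets a b → Meets b c → Meets a c
    Meets-trans {a} {b} {c} (i , i' , p) (j , j' , q) = j ℕ.+ i , i' ℕ.+ j' ,
      ≡.trans (it-+ j i a) (≡.trans (cong (it j) p) (≡.trans (≡.sym (it-+ j i' b))
      (≡.trans (cong (λ x → it x b) (ℕₚ.+-comm j i')) (≡.trans (it-+ i' j b) (≡.trans (cong (it i') q) (≡.sym (it-+ i' j' c)))))))

    -- An edge is represented by its matched vertex, which makes every `Link` an instance of
    -- `Meets`.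
    anchor : Node → Fin k
    anchor (inj₁ a) = a
    anchor (inj₂ e) = τ e

    private
      incident⇒Meets : ∀ {a e} → Incident a e → Meets a (τ e)
      incident⇒Meets {a} {e} a-e = go (shape e)
        where
        go : Shape e → Meets a (τ e)
        go (inj₂ half) = 0 , 0 , Half-only half a-e (τ-incident e)
        go (inj₁ (b , ends)) with Ends-only ends a-e
        ... | inj₁ p = 0 , 0 , p
        ... | inj₂ p = 0 , 1 , ≡.trans p (≡.sym (proj₂ (f-ends ends ≡.refl)))

      Meets-sym : ∀ {a b} → Meets a b → Meets b a
      Meets-sym (i , j , p) = j , i , ≡.sym p

      Link⇒Meets : ∀ {x y} → Link x y → Meets (anchor x) (anchor y)
      Link⇒Meets {inj₁ a} {inj₂ e} l = incident⇒Meets l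
      Link⇒Meets {inj₂ e} {inj₁ a} l = Meets-sym (incident⇒Meets l)

    connected⇒Meets : ∀ {x y} → Star Link x y → Meets (anchor x) (anchor y)
    connected⇒Meets ε        = 0 , 0 , ≡.refl
    connected⇒Meets (l ◅ ls) = Meets-trans (Link⇒Meets l) (connected⇒Meets ls)

    Periodic : Fin k → Set
    Periodic a = ∃[ p ] it (suc p) a ≡ a

    module InComponent {c : ℕ} (C : Components c) (j : Fin c) where
      open Components C
      open Component C j

      σ-incident : ∀ a → Incident a (σ a)
      σ-incident a = subst (λ x → Incident x (σ a)) (τσ a) (τ-incident (σ a))

      VIn-f : ∀ {a} → VIn a → VIn (f a)
      VIn-f {a} a-in = go (f-step a)
        where
        go : Ends (σ a) a (f a) ⊎ (Half (σ a) × f a ≡ a) → VIn (f a)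
        go (inj₁ ends)    = ≡.trans (label-incident C (Ends-incidentʳ {σ a} ends)) (≡.trans (≡.sym (label-incident C (σ-incident a))) a-in)
        go (inj₂ (_ , p)) = subst VIn (≡.sym p) a-in

      VIn-it : ∀ {a} → VIn a → ∀ i → VIn (it i a)
      VIn-it a-in zero    = a-in
      VIn-it a-in (suc i) = VIn-f (VIn-it a-in i)

      same⇒Meets : ∀ {a b} → VIn a → VIn b → Meets a b
      same⇒Meets a-in b-in = connected⇒Meets (sound _ _ (≡.trans a-in (≡.sym b-in)))

      τ-in : ∀ {e} → EIn e → VIn (τ e)
      τ-in {e} e-in = ≡.trans (label-incident C (τ-incident e)) e-in

      hasVertex : HasVertex
      hasVertex with surj j
      ... | inj₁ a , p = a , p
      ... | inj₂ e , p = τ e , τ-in p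

      -- A path in `Link` alternates between vertices and edges, and passing through an edge either
      -- crosses a full edge or returns to the same vertex.
      fullConnected : FullConnected
      fullConnected a b a-in b-in = walk a-in (sound _ _ (≡.trans a-in (≡.sym b-in)))
        where
        hop : ∀ {a b e} → EIn e → Incident a e → Incident b e → Star FullAdj a b
        hop {e = e} e-in (inj₁ p) (inj₁ q) = subst (Star FullAdj _) (ι-inj (≡.trans p (≡.sym q))) ε
        hop {e = e} e-in (inj₁ p) (inj₂ q) = (e , e-in , inj₁ (≡.sym p , ≡.sym q)) ◅ ε
        hop {e = e} e-in (inj₂ p) (inj₁ q) = (e , e-in , inj₂ (≡.sym q , ≡.sym p)) ◅ ε
        hop {e = e} e-in (inj₂ p) (inj₂ q) = subst (Star FullAdj _) (ι-inj (≡.trans p (≡.sym q))) ε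
        walk : ∀ {a b} → VIn a → Star Link (inj₁ a) (inj₁ b) → Star FullAdj a b
        walk a-in ε = ε
        walk a-in (_◅_ {j = inj₂ e} p (_◅_ {j = inj₁ b} q path)) =
          hop {e = e} e-in p q ◅◅ walk (≡.trans (label-incident C q) e-in) path
          where
          e-in : EIn e
          e-in = ≡.trans (≡.sym (label-incident C p)) a-in

      -- The arcs leaving periodic vertices: a description of the edges of a cycle that does not
      -- mention the cycle, so any two cycles of the component agree.
      OrbitEdge : Fin k → Fin k → Set
      OrbitEdge a b = VIn a × Periodic a × f a ≡ b

      module OnCycleOrbit (Z : Cycle) where
        open Cycle Z using (l; long; vert; inComp)
        open CycleSequence C j Z

        V-in : ∀ t → VIn (V t)
        V-in t = inComp _

        V-reduce : ∀ t → V (t % suc l) ≡ V t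
        V-reduce t = cong vert (mod-cong {t % suc l} {t} (DM.m%n%n≡m%n t (suc l)))

        V-suc-reduce : ∀ t → V (suc (t % suc l)) ≡ V (suc t)
        V-suc-reduce t = ≡.trans (≡.sym (V-next (t % suc l))) (≡.trans (cong (vert ∘ next) (mod-cong {t % suc l} {t} (DM.m%n%n≡m%n t (suc l)))) (V-next t))

        V-skip-small : ∀ r → r ℕ.≤ l → V r ≢ V (suc (suc r))
        V-skip-small r r≤l p with ℕₚ.m≤n⇒m<n∨m≡n r≤l
        ... | inj₂ ≡.refl = ℕₚ.<⇒≢ long (≡.sym (V-injective ℕₚ.≤-refl (ℕₚ.≤-trans (ℕₚ.n≤1+n 1) long) (≡.trans p (V-period 1))))
        ... | inj₁ r<l with ℕₚ.m≤n⇒m<n∨m≡n r<l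
        ...   | inj₁ 1+r<l  = ℕₚ.<⇒≢ (ℕₚ.m<n⇒m<1+n (ℕₚ.n<1+n r)) (V-injective r≤l 1+r<l p)
        ...   | inj₂ ≡.refl with V-injective {r} {0} r≤l ℕ.z≤n (≡.trans p V-closed)
        ...     | ≡.refl = contradiction long λ { (ℕ.s≤s ()) }

        -- The cycle has length at least 3. The index is first reduced modulo the length.
        V-skip : ∀ t → V t ≢ V (suc (suc t))
        V-skip t p = V-skip-small (t % suc l) (ℕ.s≤s⁻¹ (DM.m%n<n t (suc l)))
          (≡.trans (V-reduce t) (≡.trans p (≡.trans (≡.sym (V-suc-reduce (suc t)))
          (≡.trans (cong (V ∘ suc) (≡.trans (≡.sym (Finₚ.toℕ-fromℕ< _)) (≡.trans (cong toℕ (≡.sym (next-mod t))) (≡.trans (Finₚ.toℕ-fromℕ< _) (cong (λ x → suc x % suc l) (toℕ-mod t))))))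
          (V-suc-reduce (suc (t % suc l)))))))

        Forward Backward : ℕ → Set
        Forward t  = σ (V t) ≡ edgeAt t × f (V t) ≡ V (suc t)
        Backward t = σ (V (suc t)) ≡ edgeAt t × f (V (suc t)) ≡ V t

        oriented : ∀ t → Forward t ⊎ Backward t
        oriented t = f-oriented (edgeAt-ends t)

        -- Two consecutive edges of a cycle cannot both be matched with their common vertex.
        no-turn : ∀ t → Backward t → ¬ Forward (suc t)
        no-turn t (p , _) (q , _) = V-skip t (Ends-other {edgeAt t} (Ends-sym {edgeAt t} (edgeAt-ends t))
          (subst (λ e → Ends e (V (suc t)) (V (suc (suc t)))) (≡.trans (≡.sym q) p) (edgeAt-ends (suc t))))

        forward-below : ∀ s {t} → Forward (s ℕ.+ t) → Forward t
        forward-below zero    F = F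
        forward-below (suc s) {t} F with oriented (s ℕ.+ t)
        ... | inj₁ F' = forward-below s F'
        ... | inj₂ B  = contradiction F (no-turn (s ℕ.+ t) B)

        backward-above : ∀ s {t} → Backward t → Backward (s ℕ.+ t)
        backward-above zero    B = B
        backward-above (suc s) {t} B with oriented (suc (s ℕ.+ t))
        ... | inj₁ F  = contradiction F (no-turn (s ℕ.+ t) (backward-above s B))
        ... | inj₂ B' = B'

        traversed : (∀ t → f (V t) ≡ V (suc t)) ⊎ (∀ t → f (V (suc t)) ≡ V t)
        -- The edge at `suc l` decides: if it is forward, so are all earlier ones, which cover a
        -- full period; if it is backward, so are all later ones, and periodicity carries this to
        -- every position.
        traversed with oriented (suc l)
        ... | inj₁ F = inj₁ λ t → ≡.trans (cong f (≡.sym (V-reduce t))) (≡.trans (proj₂ (forward t)) (V-suc-reduce t))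
          where
          forward : ∀ t → Forward (t % suc l)
          forward t = forward-below (suc l ℕ.∸ t % suc l) (subst Forward (≡.sym (ℕₚ.m∸n+n≡m (ℕₚ.<⇒≤ (DM.m%n<n t (suc l))))) F)
        ... | inj₂ B = inj₂ λ t → ≡.trans (cong f (≡.sym (V-period (suc t)))) (≡.trans (proj₂ (backward-above t B)) (V-period t))

        OnZ : Fin k → Set
        OnZ a = ∃[ t ] V t ≡ a

        -- Position `t + l` serves as the predecessor of `t`, without subtraction in ℕ.
        V-wrap : ∀ t → V (suc (t ℕ.+ l)) ≡ V t
        V-wrap t = ≡.trans (cong V (≡.sym (ℕₚ.+-suc t l))) (V-period t)

        OnZ-f : ∀ {a} → OnZ a → OnZ (f a)
        OnZ-f (t , ≡.refl) with traversed
        ... | inj₁ F = suc t , ≡.sym (F t)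
        ... | inj₂ B = t ℕ.+ l , ≡.trans (≡.sym (B (t ℕ.+ l))) (cong f (V-wrap t))

        OnZ-it : ∀ {a} → OnZ a → ∀ i → OnZ (it i a)
        OnZ-it p zero    = p
        OnZ-it p (suc i) = OnZ-f (OnZ-it p i)

        OnZ⇒moves : ∀ {a} → OnZ a → f a ≢ a
        OnZ⇒moves (t , ≡.refl) p with traversed
        ... | inj₁ F = Ends-irrefl (edgeAt-ends t) (≡.trans (≡.sym p) (F t))
        ... | inj₂ B = Ends-irrefl (edgeAt-ends (t ℕ.+ l)) (≡.trans (≡.sym (B (t ℕ.+ l))) (≡.trans (cong f (V-wrap t)) (≡.trans p (≡.sym (V-wrap t)))))

        OnZ⇒Periodic : ∀ {a} → OnZ a → Periodic a
        OnZ⇒Periodic (t , ≡.refl) with traversed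
        ... | inj₁ F = l , ≡.trans (run (suc l) t) (≡.trans (cong V (ℕₚ.+-comm (suc l) t)) (V-period t))
          where
          run : ∀ s t → it s (V t) ≡ V (s ℕ.+ t)
          run zero    t = ≡.refl
          run (suc s) t = ≡.trans (cong f (run s t)) (F (s ℕ.+ t))
        ... | inj₂ B = l , ≡.trans (cong (it (suc l)) (≡.sym (≡.trans (cong V (ℕₚ.+-comm (suc l) t)) (V-period t)))) (run (suc l) t)
          where
          run : ∀ s t → it s (V (s ℕ.+ t)) ≡ V t
          run zero    t = ≡.refl
          run (suc s) t = ≡.trans (cong f (≡.trans (cong (it s ∘ V) (≡.sym (ℕₚ.+-suc s t))) (run s (suc t)))) (B t)

        -- After `i` steps the orbit of `a` is on the cycle and stays there; `i * p` further steps
        -- complete a multiple of the period `suc p` and lead back to `a`.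
        Periodic⇒OnZ : ∀ {a} → VIn a → Periodic a → OnZ a
        Periodic⇒OnZ {a} a-in (p , q) =
          let i , i' , r = same⇒Meets a-in (V-in 0)
              t , s = OnZ-it (subst OnZ (≡.sym r) (OnZ-it (0 , ≡.refl) i')) (i ℕ.* p)
          in t , ≡.trans s (≡.trans (≡.sym (it-+ (i ℕ.* p) i a))
               (≡.trans (cong (λ x → it x a) (≡.trans (ℕₚ.+-comm (i ℕ.* p) i) (≡.sym (ℕₚ.*-suc i p)))) (it-multiple (suc p) q i)))

        OnCycle⇒OrbitEdge : ∀ {a b} → OnCycle Z a b → OrbitEdge a b ⊎ OrbitEdge b a
        OnCycle⇒OrbitEdge (x , on) = go on traversed
          where
          t = toℕ x
          V-x : V t ≡ vert x
          V-x = cong vert (mod-toℕ x)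
          V-nx : V (suc t) ≡ vert (next x)
          V-nx = ≡.trans (≡.sym (V-next t)) (cong (vert ∘ next) (mod-toℕ x))
          edge-at : ∀ s {a b} → V s ≡ a → f (V s) ≡ b → OrbitEdge a b
          edge-at s ≡.refl p = V-in s , OnZ⇒Periodic (s , ≡.refl) , p
          go : ∀ {a b} → (vert x ≡ a × vert (next x) ≡ b) ⊎ (vert x ≡ b × vert (next x) ≡ a) →
               (∀ t → f (V t) ≡ V (suc t)) ⊎ (∀ t → f (V (suc t)) ≡ V t) → OrbitEdge a b ⊎ OrbitEdge b a
          go (inj₁ (p , q)) (inj₁ F) = inj₁ (edge-at t (≡.trans V-x p) (≡.trans (F t) (≡.trans V-nx q)))
          go (inj₁ (p , q)) (inj₂ B) = inj₂ (edge-at (suc t) (≡.trans V-nx q) (≡.trans (B t) (≡.trans V-x p)))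
          go (inj₂ (p , q)) (inj₁ F) = inj₂ (edge-at t (≡.trans V-x p) (≡.trans (F t) (≡.trans V-nx q)))
          go (inj₂ (p , q)) (inj₂ B) = inj₁ (edge-at (suc t) (≡.trans V-nx q) (≡.trans (B t) (≡.trans V-x p)))

        OrbitEdge⇒OnCycle : ∀ {a b} → OrbitEdge a b → OnCycle Z a b
        OrbitEdge⇒OnCycle (a-in , per , p) = go (Periodic⇒OnZ a-in per) p traversed
          where
          go : ∀ {a b} → OnZ a → f a ≡ b → (∀ t → f (V t) ≡ V (suc t)) ⊎ (∀ t → f (V (suc t)) ≡ V t) → OnCycle Z a b
          go (t , ≡.refl) p (inj₁ F) = t mod suc l , inj₁ (≡.refl , ≡.trans (V-next t) (≡.trans (≡.sym (F t)) p))
          go (t , ≡.refl) p (inj₂ B) = (t ℕ.+ l) mod suc l ,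
            inj₂ (≡.trans (≡.sym (B (t ℕ.+ l))) (≡.trans (cong f (V-wrap t)) p) , ≡.trans (V-next (t ℕ.+ l)) (V-wrap t))

        OnCycle-sym : ∀ {a b} → OnCycle Z a b → OnCycle Z b a
        OnCycle-sym (x , inj₁ p) = x , inj₂ p
        OnCycle-sym (x , inj₂ p) = x , inj₁ p

      cycles-agree : ∀ Z Z' a b → (OnCycle Z a b → OnCycle Z' a b) × (OnCycle Z' a b → OnCycle Z a b)
      cycles-agree Z Z' a b = transfer Z Z' , transfer Z' Z
        where
        transfer : ∀ Z Z' → OnCycle Z a b → OnCycle Z' a b
        transfer Z Z' = Sum.[ OnCycleOrbit.OrbitEdge⇒OnCycle Z' , OnCycleOrbit.OnCycle-sym Z' ∘ OnCycleOrbit.OrbitEdge⇒OnCycle Z' ]′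
                      ∘ OnCycleOrbit.OnCycle⇒OrbitEdge Z

      -- The vertex matched with a half edge is a fixed point of `f`. A cycle would contain it, as
      -- it contains every periodic vertex, yet `f` moves all vertices of a cycle. Two fixed points
      -- that meet are equal, so there is only one half edge.
      rootlessComponent : ∀ e → EIn e → Half e → RootlessTree
      rootlessComponent e e-in half = hasVertex , fullConnected , no-cycle , e , e-in , half , unique
        where
        no-cycle : ¬ Cycle
        no-cycle Z = OnCycleOrbit.OnZ⇒moves Z (OnCycleOrbit.Periodic⇒OnZ Z (τ-in e-in) (0 , f-half half)) (f-half half)
        unique : ∀ e' → EIn e' → Half e' → e' ≡ e
        unique e' e'-in half' =
          let i , i' , p = same⇒Meets (τ-in e'-in) (τ-in e-in)
              q = ≡.trans (≡.sym (it-fixed (f-half half') i)) (≡.trans p (it-fixed (f-half half) i'))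
          in ≡.trans (≡.sym (στ e')) (≡.trans (cong σ q) (στ e))

      module NoHalfEdge (no-half : ∀ e → EIn e → ¬ Half e) where

        step : ∀ {a} → VIn a → Ends (σ a) a (f a)
        step {a} a-in = Sum.[ id , (λ (half , _) → contradiction half (no-half (σ a) (≡.trans (≡.sym (label-incident C (σ-incident a))) a-in))) ]′ (f-step a)

        all-full : ∀ e → EIn e → Full e
        all-full e e-in = Sum.[ Ends⇒Full ∘ proj₂ , (λ half → contradiction half (no-half e e-in)) ]′ (shape e)

        periodic-vertex : ∃[ v ] VIn v × Periodic v
        periodic-vertex =
          let a , a-in = hasVertex
              -- The k + 1 iterates with exponents from 0 to k lie among k vertices.
              i , i' , i<i' , p = Finₚ.pigeonhole (ℕₚ.n<1+n k) (λ x → it (toℕ x) a)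
              d , q = ℕₚ.m≤n⇒∃[o]m+o≡n i<i'
          in it (toℕ i) a , VIn-it a-in (toℕ i) , d ,
             ≡.trans (≡.sym (it-+ (suc d) (toℕ i) a)) (≡.trans (cong (λ x → it x a) (≡.trans (cong suc (ℕₚ.+-comm d (toℕ i))) q)) (≡.sym p))

        orbitCycle : ∀ v → VIn v → ∀ l → it (suc l) v ≡ v → (∀ {i} → i ℕ.< l → it (suc i) v ≢ v) → Cycle
        orbitCycle v v-in l period minimal = record
          { l      = l
          ; long   = long
          ; vert   = λ x → it (toℕ x) v
          ; inj    = inj
          ; inComp = λ x → VIn-it v-in (toℕ x)
          ; adj    = λ x → σ (it (toℕ x) v) , ≡.trans (≡.sym (label-incident C (σ-incident (it (toℕ x) v)))) (VIn-it v-in (toℕ x))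
                     , subst (Ends (σ (it (toℕ x) v)) (it (toℕ x) v)) (adjacent x) (step (VIn-it v-in (toℕ x)))
          }
          where
          moves : f v ≢ v
          moves p = Ends-irrefl (step v-in) (≡.sym p)
          long : 2 ℕ.≤ l
          long = go l period
            where
            go : ∀ l → it (suc l) v ≡ v → 2 ℕ.≤ l
            go zero          p = contradiction p moves
            go (suc (suc l)) p = ℕ.s≤s (ℕ.s≤s ℕ.z≤n)
            -- With period 2, the vertices `v` and `f v` would be matched with the same edge and
            -- hence be equal.
            go (suc zero)    p = contradiction (≡.trans (≡.sym (τσ (f v))) (≡.trans (cong τ same-edge) (τσ v))) moves
              where
              same-edge : σ (f v) ≡ σ v
              same-edge = Ends-unique (Ends-sym {σ (f v)} (subst (Ends (σ (f v)) (f v)) p (step (VIn-f v-in)))) (step v-in)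
          distinct : ∀ {i j} → i ℕ.< j → j ℕ.≤ l → it i v ≢ it j v
          -- From a coincidence at `i` and `j`, another l - j + 1 steps complete the period from
          -- `j`; hence `v` already recurs after l - j + 1 + i steps, too early.
          distinct {i} {j} i<j j≤l p = minimal (ℕₚ.<-≤-trans (ℕₚ.+-monoʳ-< (l ℕ.∸ j) i<j) (ℕₚ.≤-reflexive (ℕₚ.m∸n+n≡m j≤l)))
            (≡.trans (it-+ (suc (l ℕ.∸ j)) i v) (≡.trans (cong (it (suc (l ℕ.∸ j))) p)
            (≡.trans (≡.sym (it-+ (suc (l ℕ.∸ j)) j v)) (≡.trans (cong (λ x → it (suc x) v) (ℕₚ.m∸n+n≡m j≤l)) period))))
          inj : ∀ (x y : Fin (suc l)) → it (toℕ x) v ≡ it (toℕ y) v → x ≡ y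
          inj x y p with ℕₚ.<-cmp (toℕ x) (toℕ y)
          ... | tri< x<y _ _ = contradiction p (distinct x<y (Finₚ.toℕ≤pred[n] y))
          ... | tri≈ _ x≡y _ = Finₚ.toℕ-injective x≡y
          ... | tri> _ _ y<x = contradiction (≡.sym p) (distinct y<x (Finₚ.toℕ≤pred[n] x))
          adjacent : ∀ (x : Fin (suc l)) → f (it (toℕ x) v) ≡ it (toℕ (next x)) v
          adjacent x with ℕₚ.m≤n⇒m<n∨m≡n (Finₚ.toℕ≤pred[n] x)
          ... | inj₁ x<l = cong (λ i → it i v) (≡.sym (≡.trans (Finₚ.toℕ-fromℕ< _) (DM.m≤n⇒m%n≡m x<l)))
          ... | inj₂ x≡l = ≡.trans (≡.trans (cong (λ i → f (it i v)) x≡l) period)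
            (cong (λ i → it i v) (≡.sym (≡.trans (Finₚ.toℕ-fromℕ< _) (≡.trans (cong (λ i → suc i % suc l) x≡l) (DM.n%n≡0 (suc l))))))

        cycle : Cycle
        cycle =
          let v , v-in , p , period = periodic-vertex
              l , period' , minimal = least (λ l → it (suc l) v Fin.≟ v) p period
          in orbitCycle v v-in l period' minimal

        unicyclicComponent : (P : ℕ → Set) → P (residue cycle) → UnicyclicWith P
        unicyclicComponent P p = all-full , hasVertex , fullConnected , cycle , p , cycles-agree cycle

      open NoHalfEdge public using (cycle; unicyclicComponent)

    -- From a nonzero determinant to type I

    module _ {c : ℕ} (C : Components c) where

      open ComponentExpansion G ι ι-inj E₁ E₁-proper E₁-unique using (Core; core-halfEdge; core-cycle; normω-Det-components)

      HalfEdgeIn : Fin c → Set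
      HalfEdgeIn j = ∃[ e ] Component.EIn C j e × Half e

      halfEdgeIn? : ∀ j → Dec (HalfEdgeIn j)
      halfEdgeIn? j = Finₚ.any? (λ e → (Components.label C (inj₂ e) Fin.≟ j) ×-dec Half? e)

      private
        none-in : ∀ {j} → ¬ HalfEdgeIn j → ∀ e → Component.EIn C j e → ¬ Half e
        none-in p e e-in half = p (e , e-in , half)

        -- The contribution of a component before its class is known; it is 0 for a cycle in Φ₄.
        factor : ∀ j → Dec (HalfEdgeIn j) → ℕ
        factor j (yes _) = 1
        factor j (no p)  = cycleWeight (Component.residue C j (InComponent.cycle C j (none-in p)))

        factor-core : ∀ j d → Core C j (factor j d)
        factor-core j (yes (e , e-in , half)) = core-halfEdge C j e e-in half
        factor-core j (no p)                  = core-cycle C j (InComponent.cycle C j (none-in p))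

      module _ (m≡k : m ≡ k) (nonzero : normω (Det (map row (allFin m)) (allFin k)) ≢ 0ω) where

        -- The norm of the determinant is the product of all factors, so a single zero factor would
        -- make it vanish.
        factor-nonzero : ∀ j → factor j (halfEdgeIn? j) ≢ 0
        factor-nonzero j p = nonzero (≡.trans
          (normω-Det-components C (λ j → factor j (halfEdgeIn? j)) (λ j → factor-core j (halfEdgeIn? j)) (InComponent.fullConnected C) m≡k)
          (cong fromℕω (0∣⇒≡0 (subst (_∣ product (map (λ j → factor j (halfEdgeIn? j)) (allFin c))) p
            (∈⇒∣product (∈ₚ.∈-map⁺ (λ j → factor j (halfEdgeIn? j)) (∈ₚ.∈-allFin j)))))))

        kindOf : ∀ j → ∃[ κ ] HasKind C j κ
        kindOf j = go (halfEdgeIn? j) (factor-nonzero j)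
          where
          go : ∀ d → factor j d ≢ 0 → ∃[ κ ] HasKind C j κ
          go (yes (e , e-in , half)) _  = rootlessTree , InComponent.rootlessComponent C j e e-in half
          go (no p)                  nz = classify (residue Z) ≡.refl (ℤDM.n%ℕd<d (twist Z) 6)
            where
            open Component C j using (residue; twist; Cycle; UnicyclicWith)
            Z : Cycle
            Z = InComponent.cycle C j (none-in p)
            unicyclic : (P : ℕ → Set) → P (residue Z) → UnicyclicWith P
            unicyclic = InComponent.unicyclicComponent C j (none-in p)
            classify : ∀ r → residue Z ≡ r → residue Z ℕ.< 6 → ∃[ κ ] HasKind C j κ
            classify 0 e _ = contradiction (cong cycleWeight e) nz
            classify 1 e _ = uniΦ₁ , unicyclic Φ₁ (inj₁ e)
            classify 2 e _ = uniΦ₂ , unicyclic Φ₂ (inj₁ e)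
            classify 3 e _ = uniΦ₃ , unicyclic Φ₃ e
            classify 4 e _ = uniΦ₂ , unicyclic Φ₂ (inj₂ e)
            classify 5 e _ = uniΦ₁ , unicyclic Φ₁ (inj₂ e)
            classify (suc (suc (suc (suc (suc (suc r)))))) e r<6 = contradiction (subst (ℕ._< 6) e r<6)
              (ℕₚ.≤⇒≯ (ℕₚ.m≤m+n 6 r))

        typeI : ∃[ γ₁ ] ∃[ γ₂ ] TypeIWith γ₁ γ₂
        typeI = _ , _ , c , C , proj₁ ∘ kindOf , proj₂ ∘ kindOf , ≡.refl , ≡.refl

  nonzero⇒typeI : m ≡ k → normω (Det (map row (allFin m)) (allFin k)) ≢ 0ω → ¬ ¬ (∃[ γ₁ ] ∃[ γ₂ ] TypeIWith γ₁ γ₂)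
  nonzero⇒typeI m≡k nz not-typeI =
    let τ , τ↭ , τ-nz = Det-nonzero⇒matching m row (allFin k) (λ z → nz (cong normω (≡.trans (cong (λ rs → Det rs (allFin k)) (Listₚ.map-tabulate id row)) z)))
    in matched τ τ↭ τ-nz
    where
    matched : (τ : Fin m → Fin k) → tabulate τ ↭ allFin k → (∀ e → row e (τ e) ≢ 0ω) → ⊥
    matched τ τ↭ τ-nz = components λ (c , C) → not-typeI (Matching.typeI τ σ τσ στ τ-incident C m≡k nz)
      where
      Incident? : ∀ a e → Dec (Incident a e)
      Incident? a e = (ι a Fin.≟ _) ⊎-dec (ι a Fin.≟ _)
      τ-incident : ∀ e → Incident (τ e) e
      τ-incident e with Incident? (τ e) e
      ... | yes p = p
      ... | no ¬p = contradiction (row-zero ¬p) (τ-nz e)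
      preimage : ∀ a → ∃[ e ] a ≡ τ e
      preimage a = ∈ₚ.∈-tabulate⁻ (↭ₚ.∈-resp-↭ (↭-sym τ↭) (∈ₚ.∈-allFin a))
      σ : Fin k → Fin m
      σ a = proj₁ (preimage a)
      τσ : ∀ a → τ (σ a) ≡ a
      τσ a = ≡.sym (proj₂ (preimage a))
      σ-injective : ∀ {a b} → σ a ≡ σ b → a ≡ b
      σ-injective {a} {b} p = ≡.trans (≡.sym (τσ a)) (≡.trans (cong τ p) (τσ b))
      σ-surjective : ∀ e → ∃[ a ] e ≡ σ a
      -- An injective map between finite sets of equal size is onto; here m ≡ k enters.
      σ-surjective e = ∈ₚ.∈-tabulate⁻ (unique⇒complete (Uniqueₚ.tabulate⁺ σ-injective) (≡.trans (Listₚ.length-tabulate σ) (≡.sym m≡k)) e)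
      στ : ∀ e → σ (τ e) ≡ e
      στ e = let a , p = σ-surjective e in ≡.trans (cong (σ ∘ τ) p) (≡.trans (cong σ (τσ a)) (≡.sym p))

-- The equality to be proved is decidable, so it may be proved by cases on whether E₁ is of type I.
substructure-value : ∀ {n k} (G : MixedGraph n) (ι : Fin k → Fin n) → Injective _≡_ _≡_ ι →
  (E₁ : List (Edge n)) → E₁ ∈ sublists (edges G) → length E₁ ≡ k → (v : ℕ) →
  (∀ γ₁ γ₂ → Substructure.TypeIWith G ι E₁ γ₁ γ₂ → v ≡ 3 ℕ.^ γ₁ ℕ.* 4 ℕ.^ γ₂) →
  ((∀ γ₁ γ₂ → ¬ Substructure.TypeIWith G ι E₁ γ₁ γ₂) → v ≡ 0) →
  normω (Det (map (λ e a → incidence G e (ι a)) E₁) (allFin k)) ≡ fromℕω v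
substructure-value {k = k} G ι ι-inj E₁ E₁∈ m≡k v v-typeI v-zero =
  ≡.trans (cong (λ rs → normω (Det rs (allFin k))) (≡.sym rows≡)) (decidable-stable (N ≟ω fromℕω v) λ N≢v →
    -- If the norm differs from `v`, then E₁ is not of type I, so `v` is 0 and the norm is nonzero;
    -- but a nonzero norm makes it contradictory that E₁ is not of type I.
    let not-typeI = λ γ₁ γ₂ t → N≢v (≡.trans (typeI-value m≡k t) (cong fromℕω (≡.sym (v-typeI γ₁ γ₂ t))))
        N≢0       = λ z → N≢v (≡.trans z (cong fromℕω (≡.sym (v-zero not-typeI))))
    in nonzero⇒typeI m≡k N≢0 λ (γ₁ , γ₂ , t) → not-typeI γ₁ γ₂ t)
  where
  E₁-proper : All (Proper G) E₁
  E₁-proper = sublists-All (All.tabulate (edges-proper G)) E₁∈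
  E₁-unique : Unique E₁
  E₁-unique = sublists-Unique (edges-unique G) E₁∈
  open IncidenceStructure G ι ι-inj E₁ E₁-proper E₁-unique using (row)
  open ComponentExpansion G ι ι-inj E₁ E₁-proper E₁-unique using (typeI-value)
  open MatchingOrientation G ι ι-inj E₁ E₁-proper E₁-unique using (nonzero⇒typeI)
  N : ℤω
  N = normω (Det (map row (allFin (length E₁))) (allFin k))
  rows≡ : map row (allFin (length E₁)) ≡ map (λ e a → incidence G e (ι a)) E₁
  rows≡ = ≡.trans (Listₚ.map-tabulate id row) (≡.trans (≡.sym (Listₚ.map-tabulate (List.lookup E₁) (λ e a → incidence G e (ι a))))
    (cong (map (λ e a → incidence G e (ι a))) (Listₚ.tabulate-lookup E₁)))

-- The sum over square substructures

open import Data.Nat using (_*_; _^_; _≟_)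

theorem2p7 : ∀ {n} (G : MixedGraph n) (k : ℕ) (ι : Fin (suc k) → Fin n) →
    Injective _≡_ _≡_ ι →
    (w : List (Edge n) → ℕ) →
    (∀ E₁ → E₁ ∈ sublists (edges G) → length E₁ ≡ suc k →
    ∀ γ₁ γ₂ → Substructure.TypeIWith G ι E₁ γ₁ γ₂ → w E₁ ≡ 3 ^ γ₁ * 4 ^ γ₂) →
    (∀ E₁ → E₁ ∈ sublists (edges G) → length E₁ ≡ suc k →
    (∀ γ₁ γ₂ → ¬ Substructure.TypeIWith G ι E₁ γ₁ γ₂) → w E₁ ≡ 0) →
    det (suc k) (principal G ι)
    ≡ fromℕω (sum (map w (filter (λ E₁ → length E₁ ≟ suc k) (sublists (edges G)))))
theorem2p7 G k ι ι-inj w w-typeI w-zero = begin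
  det (suc k) (principal G ι)
    ≡⟨ det-principal G ι ⟩
  sumω (sublists (edges G)) value
    -- Edge sets of the wrong size give matrices that are not square, with `Det` equal to 0.
    ≡⟨ sumω-filter square? (sublists (edges G)) value (λ F p → cong normω (Det-length (map rowOf F) (allFin (suc k))
         λ q → p (≡.trans (≡.sym (Listₚ.length-map rowOf F)) (≡.trans q (Listₚ.length-tabulate {n = suc k} id))))) ⟩
  sumω (filter square? (sublists (edges G))) value
    ≡⟨ sumω-cong-∈ (filter square? (sublists (edges G))) (λ F p →
         let F∈ , F-square = ∈ₚ.∈-filter⁻ square? {xs = sublists (edges G)} p
         in substructure-value G ι ι-inj F F∈ F-square (w F) (w-typeI F F∈ F-square) (w-zero F F∈ F-square)) ⟩
  sumω (filter square? (sublists (edges G))) (fromℕω ∘ w)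
    ≡⟨ fromℕω-sum (filter square? (sublists (edges G))) w ⟨
  fromℕω (sum (map w (filter square? (sublists (edges G))))) ∎
  where
  open ≡-Reasoning
  square? : ∀ E₁ → Dec (length E₁ ≡ suc k)
  square? E₁ = length E₁ ≟ suc k
  rowOf : Edge _ → Fin (suc k) → ℤω
  rowOf e a = incidence G e (ι a)
  value : List (Edge _) → ℤω
  value F = normω (Det (map rowOf F) (allFin (suc k)))
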